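{- Let $\Sigma$ be a signed graph and $v$ a vertex of $\Sigma$ such that every block of $\Sigma$ containing $v$ contains a circle, and let $C$ be a circle containing $v$. Then $[v,C,-]$ is a negative vertex battery (i.e. $C$ is negative and is the only negative circle of $\Sigma$ containing $v$) if and only if: (1) the block $B$ of $\Sigma$ containing $C$ is the only unbalanced block of $\Sigma$ containing $v$, and $\deg_B(v)=2$; and (2) $[e_v, C{\downarrow}v, -]$ is a negative edge battery in $B{\downarrow}v$, i.e. $C{\downarrow}v$ is the only negative circle of $B{\downarrow}v$ containing $e_v$.
   Context: A signed graph $\Sigma=(G,\sigma)$ is a finite graph $G$ with signature $\sigma:E(G)\to\{+,-\}$. A circle is a connected 2-regular subgraph; its sign is the product of its edge signs. A subgraph is balanced if all its circles are positive, unbalanced otherwise. A block is a maximal subgraph without a cutpoint; $\deg_B(v)$ is the number of edges of $B$ incident with $v$. If $\deg_B(v)=2$ with incident edges $vv_1,vv_2$ in $B$, suppressing $v$ means deleting $v$ and these two edges and adding a new edge $e_v$ joining $v_1$ and $v_2$ with sign $\sigma(vv_1)\sigma(vv_2)$; the result is the signed graph $B{\downarrow}v$, and for a circle $C$ of $B$ through $v$, $C{\downarrow}v$ is the corresponding circle of $B{\downarrow}v$ through $e_v$.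
   Formalization: The circle C is assumed not to be a loop: if C is a negative loop and the only negative circle at v, it is a negative vertex battery, but its block has deg_B(v)=1 and B↓v is undefined, so the claim fails. -}

module Defs where

open import Data.Bool.Base using (not; true)
open import Data.Fin.Base using (Fin; zero; suc)
open import Data.Fin.Properties using (_≟_)
open import Data.Fin.Subset using (Subset; inside; _∈_; _⊆_; _∩_; _-_; Nonempty)
open import Data.Fin.Subset.Properties using (_∈?_; x∈p∩q⁻; x∈p∧x≢y⇒x∈p-y)
open import Data.List.Base using (List; []; _∷_; length; filter; foldr; map; allFin)
import Data.List.Membership.Propositional as List
open import Data.List.Membership.Propositional.Properties using (∈-filter⁺; ∈-filter⁻; ∈-allFin)
open import Data.List.Relation.Unary.Any using (here; there)
open import Data.List.Relation.Unary.All using ([]; _∷_)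
open import Data.List.Relation.Unary.AllPairs using ([]; _∷_)
open import Data.List.Relation.Unary.Unique.Propositional using (Unique)
open import Data.List.Relation.Unary.Unique.Propositional.Properties using (allFin⁺; filter⁺)
open import Data.Nat.Base using (ℕ; suc; _+_)
open import Data.Product.Base using (_×_; _,_; ∃-syntax; proj₁; proj₂)
open import Data.Sign.Base using (Sign; _*_)
import Data.Sign.Base as Sign
open import Data.Sum.Base using (_⊎_; inj₁; inj₂)
open import Data.Vec.Base using (tabulate) renaming (_∷_ to _∷ᵛ_; there to thereᵛ)
open import Data.Vec.Properties using ([]=⇒lookup; lookup∘tabulate)
open import Relation.Binary.Construct.Closure.ReflexiveTransitive using (Star)
open import Relation.Binary.PropositionalEquality
open import Relation.Nullary.Decidable using (Dec; yes; no; does; _×-dec_; _⊎-dec_)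
open import Relation.Nullary.Negation using (¬_)

-- Vertices are named by elements of Fin n and edges by elements of Fin m; only
-- the names in V and E belong to the graph, so the ends and sign of a name
-- outside E are irrelevant.  Loops (end₁ e ≡ end₂ e) and parallel edges are
-- allowed: suppressing a vertex can create both.
record SignedGraph (n m : ℕ) : Set where
  field
    V      : Subset n
    E      : Subset m
    end₁   : Fin m → Fin n
    end₂   : Fin m → Fin n
    σ      : Fin m → Sign
    closed : ∀ {e} → e ∈ E → end₁ e ∈ V × end₂ e ∈ V

-- A set of vertices with a set of edges.  Being a subgraph of a given graph is
-- the predicate IsSubgraph, so that subgraphs are compared by _≡_.
record Part (n m : ℕ) : Set where
  constructor part
  field
    V : Subset n
    E : Subset m

open Part public

private variable
  n m : ℕ

infix 4 _⊑_

_⊑_ : Part n m → Part n m → Set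
H ⊑ K = V H ⊆ V K × E H ⊆ E K

module _ (S : SignedGraph n m) where
  private module S = SignedGraph S

  Incident : Fin m → Fin n → Set
  Incident e x = S.end₁ e ≡ x ⊎ S.end₂ e ≡ x

  incident? : ∀ e x → Dec (Incident e x)
  incident? e x = (S.end₁ e ≟ x) ⊎-dec (S.end₂ e ≟ x)

  Joins : Fin m → Fin n → Fin n → Set
  Joins e x y = (S.end₁ e ≡ x × S.end₂ e ≡ y) ⊎ (S.end₁ e ≡ y × S.end₂ e ≡ x)

  -- Meaningful only when e is incident with x.
  otherEnd : Fin m → Fin n → Fin n
  otherEnd e x with S.end₁ e ≟ x
  ... | yes _ = S.end₂ e
  ... | no  _ = S.end₁ e

  record IsSubgraph (H : Part n m) : Set where
    field
      V⊆     : V H ⊆ S.V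
      E⊆     : E H ⊆ S.E
      closed : ∀ {e} → e ∈ E H → S.end₁ e ∈ V H × S.end₂ e ∈ V H

  subgraph : (H : Part n m) → IsSubgraph H → SignedGraph n m
  subgraph H sub = record
    { V = V H ; E = E H ; end₁ = S.end₁ ; end₂ = S.end₂ ; σ = S.σ
    ; closed = IsSubgraph.closed sub }

  edgesAwayFrom : Fin n → Subset m
  edgesAwayFrom x = tabulate (λ e → not (does (incident? e x)))

  deleteVertex : Part n m → Fin n → Part n m
  deleteVertex H x = part (V H - x) (E H ∩ edgesAwayFrom x)

  Adjacent : Part n m → Fin n → Fin n → Set
  Adjacent H x y = ∃[ e ] (e ∈ E H × Joins e x y)

  Reachable : Part n m → Fin n → Fin n → Set
  Reachable H = Star (Adjacent H)

  Connected : Part n m → Set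
  Connected H = Nonempty (V H) × (∀ x y → x ∈ V H → y ∈ V H → Reachable H x y)

  -- Either deleting x separates two vertices that were joined by a path, or x
  -- supports a loop and is incident with a further edge.  The second clause is
  -- the usual convention that makes every loop a block by itself; it is void in
  -- a loopless graph.
  Cutpoint : Part n m → Fin n → Set
  Cutpoint H x = x ∈ V H ×
    ( (∃[ y ] ∃[ z ] (y ∈ V (deleteVertex H x) × z ∈ V (deleteVertex H x)
                      × Reachable H y z × ¬ Reachable (deleteVertex H x) y z))
    ⊎ (∃[ e ] ∃[ f ] (e ∈ E H × S.end₁ e ≡ x × S.end₂ e ≡ x
                      × f ∈ E H × f ≢ e × Incident f x)) )

  record IsInseparable (H : Part n m) : Set where
    field
      isSubgraph : IsSubgraph H
      connected  : Connected H
      noCutpoint : ∀ x → ¬ Cutpoint H x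

  record IsBlock (B : Part n m) : Set where
    field
      inseparable : IsInseparable B
      maximal     : ∀ H → IsInseparable H → B ⊑ H → H ⊑ B

    open IsInseparable inseparable public

  incidentEdges : Part n m → Fin n → List (Fin m)
  incidentEdges H x = filter (λ e → (e ∈? E H) ×-dec incident? e x) (allFin m)

  -- The number of edges incident with x; a loop counts once.
  deg : Part n m → Fin n → ℕ
  deg H x = length (incidentEdges H x)

  -- The number of edge ends at x; a loop counts twice, so that a vertex with a
  -- single loop is 2-regular.
  valency : Part n m → Fin n → ℕ
  valency H x =
      length (filter (λ e → (e ∈? E H) ×-dec (S.end₁ e ≟ x)) (allFin m))
    + length (filter (λ e → (e ∈? E H) ×-dec (S.end₂ e ≟ x)) (allFin m))

  record IsCircle (C : Part n m) : Set where
    field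
      isSubgraph : IsSubgraph C
      connected  : Connected C
      twoRegular : ∀ x → x ∈ V C → valency C x ≡ 2

  signOf : Part n m → Sign
  signOf H = foldr _*_ Sign.+ (map S.σ (filter (_∈? E H) (allFin m)))

  Negative : Part n m → Set
  Negative C = signOf C ≡ Sign.-

  Balanced : Part n m → Set
  Balanced H = ∀ D → IsCircle D → D ⊑ H → signOf D ≡ Sign.+

  Unbalanced : Part n m → Set
  Unbalanced H = ¬ Balanced H

  record NegativeVertexBattery (v : Fin n) (C : Part n m) : Set where
    field
      circle   : IsCircle C
      contains : v ∈ V C
      negative : Negative C
      unique   : ∀ D → IsCircle D → v ∈ V D → Negative D → D ≡ C

  record NegativeEdgeBattery (e : Fin m) (C : Part n m) : Set where
    field
      circle   : IsCircle C
      contains : e ∈ E C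
      negative : Negative C
      unique   : ∀ D → IsCircle D → e ∈ E D → Negative D → D ≡ C

  NoLoopAt : Part n m → Fin n → Set
  NoLoopAt H x = ∀ e → e ∈ E H → ¬ (S.end₁ e ≡ x × S.end₂ e ≡ x)

asPair : ∀ {A : Set} (xs : List A) → length xs ≡ 2 → ∃[ a ] ∃[ b ] (xs ≡ a ∷ b ∷ [])
asPair (a ∷ b ∷ []) refl = a , b , refl

module _ (S : SignedGraph n m) where
  private module S = SignedGraph S

  private
    otherEnd-in : ∀ {H} → IsSubgraph S H → ∀ {e x} → e ∈ E H → Incident S e x →
      ¬ (S.end₁ e ≡ x × S.end₂ e ≡ x) → otherEnd S e x ∈ V H - x
    otherEnd-in sub {e} {x} e∈ inc nl with S.end₁ e ≟ x
    ... | yes p = x∈p∧x≢y⇒x∈p-y (proj₂ (IsSubgraph.closed sub e∈)) (λ q → nl (p , q))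
    ... | no ¬p = x∈p∧x≢y⇒x∈p-y (proj₁ (IsSubgraph.closed sub e∈)) ¬p

    ∈-incidentEdges⁻ : ∀ H x {e} → e List.∈ incidentEdges S H x → e ∈ E H × Incident S e x
    ∈-incidentEdges⁻ H x e∈ =
      proj₂ (∈-filter⁻ (λ e → (e ∈? E H) ×-dec incident? S e x) {xs = allFin m} e∈)

    away⇒¬incident : ∀ {e x} → e ∈ edgesAwayFrom S x → ¬ Incident S e x
    away⇒¬incident {e} {x} e∈ =
      refuted (incident? S e x) (trans (sym (lookup∘tabulate _ e)) ([]=⇒lookup e∈))
      where
      refuted : ∀ {P : Set} (P? : Dec P) → not (does P?) ≡ true → ¬ P
      refuted (no ¬p) _ = ¬p

  -- H↓v.  The edge named zero is the new edge e_v, and an old edge e is renamed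
  -- suc e.
  suppress : (H : Part n m) → IsSubgraph S H → (v : Fin n) →
             deg S H v ≡ 2 → NoLoopAt S H v → SignedGraph n (suc m)
  suppress H sub v d nl = record
    { V = V H - v
    ; E = inside ∷ᵛ (E H ∩ edgesAwayFrom S v)
    ; end₁ = λ { zero → otherEnd S f v ; (suc e) → S.end₁ e }
    ; end₂ = λ { zero → otherEnd S g v ; (suc e) → S.end₂ e }
    ; σ = λ { zero → S.σ f * S.σ g ; (suc e) → S.σ e }
    ; closed = λ { {zero} _ → new (here refl) , new (there (here refl))
                 ; {suc e} (thereᵛ e∈) → old e∈ } }
    where
    two = asPair (incidentEdges S H v) d
    f   = proj₁ two
    g   = proj₁ (proj₂ two)
    eq  = proj₂ (proj₂ two)

    new : ∀ {e} → e List.∈ (f ∷ g ∷ []) → otherEnd S e v ∈ V H - v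
    new e∈ with ∈-incidentEdges⁻ H v (subst (_ List.∈_) (sym eq) e∈)
    ... | e∈H , inc = otherEnd-in sub e∈H inc (nl _ e∈H)

    old : ∀ {e} → e ∈ E H ∩ edgesAwayFrom S v → S.end₁ e ∈ V H - v × S.end₂ e ∈ V H - v
    old e∈ with x∈p∩q⁻ (E H) (edgesAwayFrom S v) e∈
    ... | e∈H , away =
        x∈p∧x≢y⇒x∈p-y (proj₁ (IsSubgraph.closed sub e∈H)) (λ p → away⇒¬incident away (inj₁ p))
      , x∈p∧x≢y⇒x∈p-y (proj₂ (IsSubgraph.closed sub e∈H)) (λ p → away⇒¬incident away (inj₂ p))

  -- C↓v, for a circle C through v, in the edge naming of suppress.
  suppressCircle : Part n m → Fin n → Part n (suc m)
  suppressCircle C v = part (V C - v) (inside ∷ᵛ (E C ∩ edgesAwayFrom S v))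

  block-noLoop : ∀ {B} → IsBlock S B → ∀ v → deg S B v ≡ 2 → NoLoopAt S B v
  block-noLoop {B} blk v d e e∈ (p , q)
    with asPair (incidentEdges S B v) d
  ... | f , g , eq = contra (subst Unique eq uniq) (subst (e List.∈_) eq e∈L)
    where
    P? = λ e′ → (e′ ∈? E B) ×-dec incident? S e′ v

    uniq : Unique (incidentEdges S B v)
    uniq = filter⁺ P? (allFin⁺ m)

    e∈L : e List.∈ incidentEdges S B v
    e∈L = ∈-filter⁺ P? (∈-allFin e) (e∈ , inj₁ p)

    v∈B : v ∈ V B
    v∈B = subst (_∈ V B) p (proj₁ (IsSubgraph.closed (IsBlock.isSubgraph blk) e∈))

    cut : ∀ {h} → h List.∈ (f ∷ g ∷ []) → ¬ (h ≢ e)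
    cut h∈ h≢e with ∈-incidentEdges⁻ B v (subst (_ List.∈_) (sym eq) h∈)
    ... | h∈B , inc =
      IsBlock.noCutpoint blk v (v∈B , inj₂ (e , _ , e∈ , p , q , h∈B , h≢e , inc))

    contra : Unique (f ∷ g ∷ []) → ¬ (e List.∈ (f ∷ g ∷ []))
    contra ((f≢g ∷ []) ∷ _) (here refl) = cut (there (here refl)) (λ g≡f → f≢g (sym g≡f))
    contra ((f≢g ∷ []) ∷ _) (there (here refl)) = cut (here refl) f≢g
    contra _ (there (there ()))

  suppressBlock : ∀ {B} → IsBlock S B → (v : Fin n) → deg S B v ≡ 2 → SignedGraph n (suc m)
  suppressBlock {B} blk v d =
    suppress B (IsBlock.isSubgraph blk) v d (block-noLoop blk v d)

{-# OPTIONS --safe #-}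

-- The key fact is that in an inseparable graph a negative circle D can be
-- rerouted through any edge f that leaves it at a vertex w: prolong f, without
-- returning to w, until it meets D again.  The result is a theta graph, two of
-- whose circles contain f, and as D is negative so is one of these two.
-- Hence every vertex of an unbalanced block lies on a negative circle, and if C
-- is the only negative circle through v, then no edge of B at v lies outside C.
-- The remaining content is the bijection between the circles of B through v and
-- those of B↓v through e_v.
-- Deleting a vertex that is not a cutpoint preserves reachability only up to
-- double negation; this suffices because parts are compared decidably.
module Submission where

open import Defs
open import Data.Bool.Base using (if_then_else_; not)
open import Data.Fin.Base using (Fin; zero; suc)
open import Data.Fin.Properties using (_≟_; any?)
open import Data.Fin.Subset
  using (Subset; _∈_; _∉_; _⊆_; _⊂_; _∪_; _-_; _─_; ⁅_⁆; ⊥; inside; outside; ∣_∣)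
open import Data.Fin.Subset.Properties
  using ( _∈?_; _⊆?_; ⊆-antisym; drop-there; ∉⊥; x∈⁅x⁆; x∈⁅y⁆⇒x≡y
        ; x∈p∪q⁺; x∈p∪q⁻; x∈p∩q⁺; x∈p∩q⁻; p─q⊆p; x∈p∧x≢y⇒x∈p-y
        ; p⊆q⇒∣p∣≤∣q∣; p⊂q⇒∣p∣<∣q∣; ∣p∣≤n )
open import Data.List.Base using (List; []; _∷_; _++_; length; filter; foldr; map; allFin)
open import Data.List.Membership.Propositional using () renaming (_∈_ to _∈ˡ_; _∉_ to _∉ˡ_)
open import Data.List.Membership.Propositional.Properties
  using (∈-filter⁺; ∈-filter⁻; ∈-allFin; ∈-∃++; ∈-++⁺ˡ; ∈-++⁺ʳ; ∈-++⁻; ∈-map⁺; ∈-map⁻)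
open import Data.List.Membership.Propositional.Properties.WithK using (unique∧set⇒bag)
open import Data.List.Properties using (length-tabulate)
open import Data.List.Relation.Binary.BagAndSetEquality using (∼bag⇒↭)
open import Data.List.Relation.Binary.Permutation.Propositional
  using (_↭_; ↭-refl; ↭-sym; ↭-trans; ↭-prep; ↭-reflexive; ↭⇒↭ₛ)
open import Data.List.Relation.Binary.Permutation.Propositional.Properties
  using (shift; ↭-length; ∈-resp-↭; ∷↭∷ʳ; map⁺)
open import Data.List.Relation.Binary.Permutation.Setoid.Properties using (foldr-commMonoid)
import Data.List.Relation.Unary.All as All
open import Data.List.Relation.Unary.All using ([]; _∷_)
open import Data.List.Relation.Unary.AllPairs using ([]; _∷_)
import Data.List.Relation.Unary.Any as Any
open import Data.List.Relation.Unary.Any using (here; there)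
open import Data.List.Relation.Unary.Unique.Propositional using (Unique)
open import Data.List.Relation.Unary.Unique.Propositional.Properties
  using (allFin⁺; filter⁺; Unique[x∷xs]⇒x∉xs)
open import Data.Nat.Base using (ℕ; zero; suc; _+_; _*_; _≤_; _<_; z≤n; s≤s)
open import Data.Nat.Properties
  using ( +-suc; +-comm; +-identityʳ; suc-injective; n≤1+n; m≤n+m; ≤⇒≯; ≤-refl; ≤-antisym
        ; ≤-trans; ≤-reflexive; +-mono-≤; +-mono-<-≤; +-mono-≤-<; +-monoˡ-≤ )
open import Data.Nat.Solver using (module +-*-Solver)
open import Data.Product.Base using (_×_; _,_; Σ-syntax; ∃-syntax; proj₁; proj₂)
import Data.Sign.Base as Sign
open import Data.Sign.Base using (Sign)
import Data.Sign.Properties as Sign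
import Data.Sum.Base as Sum
open import Data.Sum.Base using (_⊎_; inj₁; inj₂; [_,_]′)
open import Data.Vec.Base using ([]; _∷_; here; there)
open import Data.Vec.Properties using ([]=⇒lookup; lookup⇒[]=; lookup∘tabulate)
open import Function.Base using (_∘_; _$_; case_of_)
open import Function.Bundles using (_⇔_; mk⇔; Equivalence)
import Relation.Binary.Construct.Closure.ReflexiveTransitive as Star
open import Relation.Binary.Construct.Closure.ReflexiveTransitive using (ε; _◅_; _◅◅_; reverse)
open import Relation.Binary.PropositionalEquality
  using (_≡_; _≢_; refl; sym; trans; cong; cong₂; subst; setoid)
open import Relation.Nullary.Decidable
  using (Dec; yes; no; does; decidable-stable; dec-true; dec-false; _×-dec_; ¬?)
open import Relation.Nullary.Negation using (¬_; contradiction)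

-- A circle is given as a connected 2-regular part, that is, as two sets without an order, whereas
-- cutting and regluing need one. Every circle is therefore turned into a `Traversal`, a simple path
-- with a closing edge, and back; both passages count edge ends. All constructions of circles,
-- namely the two circles of the theta graph and the passage between `B` and its suppression, are
-- surgery on such paths. The circle `C` is assumed to be without loops. A negative loop at `v` can
-- be the only negative circle through `v`, but it is a block by itself and `deg` counts its edge
-- once, so the degree condition would fail. In the proof this assumption supplies a second vertex
-- of `C`, and two common vertices are what forces two blocks to coincide.

unique⇒length≤ : ∀ {A : Set} {xs ys : List A} → Unique xs →
                 (∀ {z} → z ∈ˡ xs → z ∈ˡ ys) → length xs ≤ length ys
unique⇒length≤ [] _ = z≤n
unique⇒length≤ {xs = x ∷ xs} u@(_ ∷ u′) xs⊆ys
  with as , bs , refl ← ∈-∃++ (xs⊆ys (here refl)) =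
  ≤-trans (s≤s (unique⇒length≤ u′ rest)) (≤-reflexive (sym (↭-length (shift x as bs))))
  where
  rest : ∀ {z} → z ∈ˡ xs → z ∈ˡ as ++ bs
  rest z∈ with ∈-resp-↭ (shift x as bs) (xs⊆ys (there z∈))
  ... | here refl = contradiction z∈ (Unique[x∷xs]⇒x∉xs u)
  ... | there z∈′ = z∈′

infix 4 _∈ˡ?_

_∈ˡ?_ : ∀ {k} (x : Fin k) xs → Dec (x ∈ˡ xs)
x ∈ˡ? xs = Any.any? (x ≟_) xs

∉⇒unique-∷ : ∀ {A : Set} {x : A} {xs} → x ∉ˡ xs → Unique xs → Unique (x ∷ xs)
∉⇒unique-∷ x∉ u = All.tabulate (λ { y∈ refl → x∉ y∈ }) ∷ u

part-≡ : ∀ {n m} {H K : Part n m} → H ⊑ K → K ⊑ H → H ≡ K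
part-≡ (V⊆ , E⊆) (V⊇ , E⊇) = cong₂ part (⊆-antisym V⊆ V⊇) (⊆-antisym E⊆ E⊇)

fromList : ∀ {k} → List (Fin k) → Subset k
fromList = foldr (λ x p → ⁅ x ⁆ ∪ p) ⊥

∈-fromList⁺ : ∀ {k} {x : Fin k} {xs} → x ∈ˡ xs → x ∈ fromList xs
∈-fromList⁺ (here refl) = x∈p∪q⁺ (inj₁ (x∈⁅x⁆ _))
∈-fromList⁺ (there x∈) = x∈p∪q⁺ (inj₂ (∈-fromList⁺ x∈))

∈-fromList⁻ : ∀ {k} {x : Fin k} xs → x ∈ fromList xs → x ∈ˡ xs
∈-fromList⁻ [] x∈ = contradiction x∈ ∉⊥
∈-fromList⁻ (y ∷ xs) x∈ with x∈p∪q⁻ ⁅ y ⁆ (fromList xs) x∈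
... | inj₁ x∈y = here (x∈⁅y⁆⇒x≡y y x∈y)
... | inj₂ x∈xs = there (∈-fromList⁻ xs x∈xs)

x∈p─q⇒x∉q : ∀ {k} {x : Fin k} (p : Subset k) {q} → x ∈ p ─ q → x ∉ q
x∈p─q⇒x∉q (_ ∷ p) {outside ∷ q} (there x∈) (there x∈q) = x∈p─q⇒x∉q p x∈ x∈q
x∈p─q⇒x∉q (_ ∷ p) {inside ∷ q} (there x∈) (there x∈q) = x∈p─q⇒x∉q p x∈ x∈q

⊆∧⊉⇒⊂ : ∀ {k} {p q : Subset k} → p ⊆ q → ¬ q ⊆ p → p ⊂ q
⊆∧⊉⇒⊂ {p = p} {q} p⊆q q⊈p with any? (λ x → (x ∈? q) ×-dec ¬? (x ∈? p))
... | yes new = p⊆q , new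
... | no none = contradiction
        (λ {x} x∈q → decidable-stable (x ∈? p) λ x∉p → none (x , x∈q , x∉p)) q⊈p

-- The Kronecker delta. An edge contributes the deltas of both its ends to a degree, so a loop
-- contributes two.
δ : ∀ {n} → Fin n → Fin n → ℕ
δ x z = if does (x ≟ z) then 1 else 0

δ-refl : ∀ {n} (z : Fin n) → δ z z ≡ 1
δ-refl z with z ≟ z
... | yes _ = refl
... | no z≢z = contradiction refl z≢z

δ-≢ : ∀ {n} {x z : Fin n} → x ≢ z → δ x z ≡ 0
δ-≢ {x = x} {z} x≢z with x ≟ z
... | yes x≡z = contradiction x≡z x≢z
... | no _ = refl

-- Degrees along edge lists, and simple paths

module _ {n m : ℕ} (S : SignedGraph n m) where
  private module S = SignedGraph S

  -- `valency` filters the edge names of the whole graph; counting along an explicit list permits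
  -- induction on the list. The two counts are compared below by inclusion of lists, where only
  -- `degree≤valency` needs the list to be free of repetitions.
  degree : List (Fin m) → Fin n → ℕ
  degree es z = length (filter (λ e → S.end₁ e ≟ z) es)
              + length (filter (λ e → S.end₂ e ≟ z) es)

  degree-∷ : ∀ e es z → degree (e ∷ es) z ≡ (δ (S.end₁ e) z + δ (S.end₂ e) z) + degree es z
  degree-∷ e es z with S.end₁ e ≟ z | S.end₂ e ≟ z
  ... | yes _ | yes _ = cong suc (+-suc _ _)
  ... | yes _ | no  _ = refl
  ... | no  _ | yes _ = +-suc _ _
  ... | no  _ | no  _ = refl

  degree≤valency : ∀ {es} C → Unique es → (∀ {e} → e ∈ˡ es → e ∈ E C) →
                   ∀ z → degree es z ≤ valency S C z
  degree≤valency {es} C u es⊆ z = +-mono-≤ (half S.end₁) (half S.end₂)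
    where
    half : ∀ (end : Fin m → Fin n) →
           length (filter (λ e → end e ≟ z) es)
             ≤ length (filter (λ e → (e ∈? E C) ×-dec (end e ≟ z)) (allFin m))
    half end = unique⇒length≤ (filter⁺ (λ e → end e ≟ z) u) λ e∈ →
      let e∈es , eq = ∈-filter⁻ (λ e → end e ≟ z) {xs = es} e∈
      in ∈-filter⁺ (λ e → (e ∈? E C) ×-dec (end e ≟ z)) (∈-allFin _) (es⊆ e∈es , eq)

  valency≤degree : ∀ es C z → (∀ {e} → e ∈ E C → Incident S e z → e ∈ˡ es) →
                   valency S C z ≤ degree es z
  valency≤degree es C z C⊆ = +-mono-≤ (half S.end₁ inj₁) (half S.end₂ inj₂)
    where
    half : ∀ (end : Fin m → Fin n) → (∀ {e} → end e ≡ z → Incident S e z) →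
           length (filter (λ e → (e ∈? E C) ×-dec (end e ≟ z)) (allFin m))
             ≤ length (filter (λ e → end e ≟ z) es)
    half end inc = unique⇒length≤ (filter⁺ _ (allFin⁺ m)) λ e∈ →
      let _ , e∈C , eq = ∈-filter⁻ (λ e → (e ∈? E C) ×-dec (end e ≟ z)) {xs = allFin m} e∈
      in ∈-filter⁺ (λ e → end e ≟ z) (C⊆ e∈C (inc eq)) eq

  joins-sym : ∀ {e x y} → Joins S e x y → Joins S e y x
  joins-sym (inj₁ j) = inj₂ j
  joins-sym (inj₂ j) = inj₁ j

  joins⇒incidentˡ : ∀ {e x y} → Joins S e x y → Incident S e x
  joins⇒incidentˡ (inj₁ (p , _)) = inj₁ p
  joins⇒incidentˡ (inj₂ (_ , q)) = inj₂ q

  incident⇒joins : ∀ {e x} → Incident S e x → ∃[ y ] Joins S e x y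
  incident⇒joins (inj₁ p) = _ , inj₁ (p , refl)
  incident⇒joins (inj₂ q) = _ , inj₂ (refl , q)

  joins-incident : ∀ {e x y z} → Joins S e x y → Incident S e z → z ≡ x ⊎ z ≡ y
  joins-incident (inj₁ (refl , refl)) (inj₁ refl) = inj₁ refl
  joins-incident (inj₁ (refl , refl)) (inj₂ refl) = inj₂ refl
  joins-incident (inj₂ (refl , refl)) (inj₁ refl) = inj₂ refl
  joins-incident (inj₂ (refl , refl)) (inj₂ refl) = inj₁ refl

  joins-δ : ∀ {e x y} → Joins S e x y → ∀ z → δ (S.end₁ e) z + δ (S.end₂ e) z ≡ δ x z + δ y z
  joins-δ (inj₁ (refl , refl)) z = refl
  joins-δ {x = x} (inj₂ (refl , refl)) z = +-comm _ (δ x z)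

  -- Defined by induction-recursion with `verts`, so that simplicity is part of the data: each new
  -- vertex must avoid the rest of the path. That the edges are distinct then follows.
  data Path : Fin n → Fin n → Set
  verts : ∀ {x y} → Path x y → List (Fin n)

  data Path where
    stop : ∀ x → Path x x
    step : ∀ {x x′ y} e → Joins S e x x′ → (p : Path x′ y) → x ∉ˡ verts p → Path x y

  verts (stop x) = x ∷ []
  verts (step {x} _ _ p _) = x ∷ verts p

  edges : ∀ {x y} → Path x y → List (Fin m)
  edges (stop _) = []
  edges (step e _ p _) = e ∷ edges p

  start∈verts : ∀ {x y} (p : Path x y) → x ∈ˡ verts p
  start∈verts (stop _) = here refl
  start∈verts (step _ _ _ _) = here refl

  finish∈verts : ∀ {x y} (p : Path x y) → y ∈ˡ verts p
  finish∈verts (stop _) = here refl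
  finish∈verts (step _ _ p _) = there (finish∈verts p)

  incident⇒∈verts : ∀ {x y e z} (p : Path x y) → e ∈ˡ edges p → Incident S e z → z ∈ˡ verts p
  incident⇒∈verts (step _ j p _) (here refl) inc with joins-incident j inc
  ... | inj₁ refl = here refl
  ... | inj₂ refl = there (start∈verts p)
  incident⇒∈verts (step _ _ p _) (there e∈) inc = there (incident⇒∈verts p e∈ inc)

  away⇒∉edges : ∀ {x y e z} (p : Path x y) → z ∉ˡ verts p → Incident S e z → e ∉ˡ edges p
  away⇒∉edges p z∉ inc e∈ = z∉ (incident⇒∈verts p e∈ inc)

  edges-unique : ∀ {x y} (p : Path x y) → Unique (edges p)
  edges-unique (stop _) = []
  edges-unique (step e j p x∉) =
    ∉⇒unique-∷ (away⇒∉edges p x∉ (joins⇒incidentˡ j)) (edges-unique p)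

  -- Always 0 or 1, the path being simple. Written as a sum of deltas, it lets `path-degree` be
  -- proved by adding up identities edge by edge.
  multiplicity : ∀ {x y} → Path x y → Fin n → ℕ
  multiplicity (stop x) z = δ x z
  multiplicity (step {x} _ _ p _) z = δ x z + multiplicity p z

  multiplicity-∉ : ∀ {x y z} (p : Path x y) → z ∉ˡ verts p → multiplicity p z ≡ 0
  multiplicity-∉ {z = z} (stop x) z∉ = δ-≢ {x = x} {z} λ { refl → z∉ (here refl) }
  multiplicity-∉ {z = z} (step {x} _ _ p _) z∉
    rewrite multiplicity-∉ p (z∉ ∘ there) = cong (_+ 0) (δ-≢ {x = x} {z} λ { refl → z∉ (here refl) })

  multiplicity-∈ : ∀ {x y z} (p : Path x y) → z ∈ˡ verts p → multiplicity p z ≡ 1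
  multiplicity-∈ (stop x) (here refl) = δ-refl x
  multiplicity-∈ (step {x} _ _ p x∉) (here refl)
    rewrite multiplicity-∉ p x∉ = cong (_+ 0) (δ-refl x)
  multiplicity-∈ {z = z} (step {x} _ _ p x∉) (there z∈)
    rewrite multiplicity-∈ p z∈ = cong (_+ 1) (δ-≢ {x = x} {z} λ { refl → x∉ z∈ })

  -- Every visit to a vertex uses two edge ends, except that the first and the last visit lack one
  -- each; the deltas on the left fill these two gaps. In `closed-degree` a closing edge fills them
  -- instead.
  path-degree : ∀ {x y} (p : Path x y) z →
                degree (edges p) z + (δ x z + δ y z) ≡ 2 * multiplicity p z
  path-degree (stop x) z = solve 1 (λ a → a :+ a := con 2 :* a) refl (δ x z)
    where open +-*-Solver
  path-degree {y = y} (step {x} {x′} e j p _) z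
    rewrite degree-∷ e (edges p) z | joins-δ j z = trans
      (solve 4 (λ a b c d → (a :+ b :+ c) :+ (a :+ d) := con 2 :* a :+ (c :+ (b :+ d)))
        refl (δ x z) (δ x′ z) (degree (edges p) z) (δ y z))
      (trans (cong (2 * δ x z +_) (path-degree p z))
        (solve 2 (λ a b → con 2 :* a :+ con 2 :* b := con 2 :* (a :+ b))
          refl (δ x z) (multiplicity p z)))
    where open +-*-Solver

  closed-degree : ∀ {x y e} (p : Path x y) → Joins S e y x → ∀ z →
                  degree (e ∷ edges p) z ≡ 2 * multiplicity p z
  closed-degree {x} {y} {e} p j z
    rewrite degree-∷ e (edges p) z | joins-δ (joins-sym j) z =
    trans (+-comm _ (degree (edges p) z)) (path-degree p z)

  adjacent-sym : ∀ {H x y} → Adjacent S H x y → Adjacent S H y x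
  adjacent-sym (e , e∈ , j) = e , e∈ , joins-sym j

  reachable-sym : ∀ {H x y} → Reachable S H x y → Reachable S H y x
  reachable-sym {H} = reverse (adjacent-sym {H})

  path-reachable : ∀ H {x y z} (p : Path x y) → (∀ {e} → e ∈ˡ edges p → e ∈ E H) →
                   z ∈ˡ verts p → Reachable S H x z
  path-reachable H (stop _) _ (here refl) = ε
  path-reachable H (step _ _ _ _) _ (here refl) = ε
  path-reachable H (step e j p _) p⊆ (there z∈) =
    (e , p⊆ (here refl) , j) ◅ path-reachable H p (p⊆ ∘ there) z∈

  -- The circle `C` cut open at its edge `e`: a simple path from `x` to `y` runs through the rest,
  -- and `e` leads back. If `e` is a loop, the path is `stop`.
  record Traversal (C : Part n m) (e : Fin m) (x y : Fin n) : Set where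
    field
      path   : Path x y
      closes : Joins S e y x
      fresh  : e ∉ˡ edges path
      ∈V⇒    : ∀ {z} → z ∈ V C → z ∈ˡ verts path
      ⇒∈V    : ∀ {z} → z ∈ˡ verts path → z ∈ V C
      ∈E⇒    : ∀ {f} → f ∈ E C → f ∈ˡ e ∷ edges path
      ⇒∈E    : ∀ {f} → f ∈ˡ e ∷ edges path → f ∈ E C

    incident⇒∈V : ∀ {f z} → f ∈ E C → Incident S f z → z ∈ˡ verts path
    incident⇒∈V f∈ inc with ∈E⇒ f∈
    ... | there f∈p = incident⇒∈verts path f∈p inc
    ... | here refl with joins-incident closes inc
    ...   | inj₁ refl = finish∈verts path
    ...   | inj₂ refl = start∈verts path

    edges-unique′ : Unique (e ∷ edges path)
    edges-unique′ = ∉⇒unique-∷ fresh (edges-unique path)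

    degree≡2 : ∀ {z} → z ∈ˡ verts path → degree (e ∷ edges path) z ≡ 2
    degree≡2 z∈ = trans (closed-degree path closes _) (cong (2 *_) (multiplicity-∈ path z∈))

  wholeGraph : Part n m
  wholeGraph = part S.V S.E

  traversal⇒circle : ∀ {C e x y} → C ⊑ wholeGraph → Traversal C e x y → IsCircle S C
  traversal⇒circle {C} {x = x} (V⊆ , E⊆) t = record
    { isSubgraph = record
      { V⊆ = V⊆ ; E⊆ = E⊆
      ; closed = λ f∈ → ⇒∈V (incident⇒∈V f∈ (inj₁ refl)) , ⇒∈V (incident⇒∈V f∈ (inj₂ refl)) }
    ; connected = (x , ⇒∈V (start∈verts path)) ,
        λ y z y∈ z∈ → reachable-sym {C} (from-start y∈) ◅◅ from-start z∈
    ; twoRegular = λ z z∈ → trans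
        (≤-antisym (valency≤degree _ C z (λ f∈ _ → ∈E⇒ f∈)) (degree≤valency C edges-unique′ ⇒∈E z))
        (degree≡2 (∈V⇒ z∈)) }
    where
    open Traversal t
    from-start : ∀ {z} → z ∈ V C → Reachable S C x z
    from-start z∈ = path-reachable C path (⇒∈E ∘ there) (∈V⇒ z∈)

  joins-closed : ∀ {H e x y} → IsSubgraph S H → e ∈ E H → Joins S e x y → x ∈ V H × y ∈ V H
  joins-closed sub e∈ (inj₁ (refl , refl)) = IsSubgraph.closed sub e∈
  joins-closed sub e∈ (inj₂ (refl , refl)) =
    proj₂ (IsSubgraph.closed sub e∈) , proj₁ (IsSubgraph.closed sub e∈)

  -- A path in a circle that begins with e can be prolonged until it returns:
  -- its last vertex has a second edge, whose other end is new because every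
  -- vertex behind it has already used up its valency.
  module _ {C : Part n m} (circle : IsCircle S C) {e : Fin m} {x y : Fin n}
           (e∈ : e ∈ E C) (j : Joins S e y x) where
    open IsCircle circle

    private
      degree≤2 : ∀ {es z} → z ∈ V C → Unique es → (∀ {f} → f ∈ˡ es → f ∈ E C) → degree es z ≤ 2
      degree≤2 z∈ u es⊆ = ≤-trans (degree≤valency C u es⊆ _) (≤-reflexive (twoRegular _ z∈))

      ∷⊆ : ∀ {f es} → f ∈ E C → (∀ {g} → g ∈ˡ es → g ∈ E C) → ∀ {g} → g ∈ˡ f ∷ es → g ∈ E C
      ∷⊆ f∈ es⊆ (here refl) = f∈
      ∷⊆ f∈ es⊆ (there g∈) = es⊆ g∈

      open +-*-Solver

      degree-start : ∀ {z} (p : Path z y) → z ≢ x → degree (e ∷ edges p) z ≡ 1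
      degree-start {z} p z≢x
        with eq ← path-degree p z
        rewrite degree-∷ e (edges p) z | joins-δ j z | δ-≢ {x = x} {z} (z≢x ∘ sym)
              | δ-refl z | multiplicity-∈ p (start∈verts p) =
        suc-injective (trans (solve 2 (λ a b → con 1 :+ (a :+ con 0 :+ b) := b :+ (con 1 :+ a))
          refl (δ y z) (degree (edges p) z)) eq)

      degree-back : ∀ {z z′ g} (p : Path z y) → Joins S g z z′ → z′ ∈ˡ verts p →
                    degree (g ∷ e ∷ edges p) z′ ≡ 3 + δ x z′
      degree-back {z} {z′} {g} p jg z′∈
        with eq ← path-degree p z′
        rewrite degree-∷ g (e ∷ edges p) z′ | joins-δ jg z′ | degree-∷ e (edges p) z′ | joins-δ j z′
              | δ-refl z′ | multiplicity-∈ p z′∈ =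
        trans (solve 4 (λ a b c d → a :+ con 1 :+ (b :+ c :+ d) := (d :+ (a :+ b)) :+ (con 1 :+ c))
          refl (δ z z′) (δ y z′) (δ x z′) (degree (edges p) z′)) (cong (_+ (1 + δ x z′)) eq)

      prolong : ∀ k {z} (p : Path z y) → z ∈ V C → (∀ {f} → f ∈ˡ edges p → f ∈ E C) →
                e ∉ˡ edges p → m ≤ length (edges p) + k →
                Σ[ q ∈ Path x y ] ((∀ {f} → f ∈ˡ edges q → f ∈ E C) × e ∉ˡ edges q)
      prolong k {z} p z∈ p⊆ e∉ m≤ with z ≟ x
      ... | yes refl = p , (λ f∈ → p⊆ f∈) , e∉
      ... | no z≢x
        with any? (λ g → (g ∈? E C) ×-dec (incident? S g z) ×-dec ¬? (g ∈ˡ? e ∷ edges p))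
      ...   | no none = contradiction
              (≤-trans (≤-reflexive (sym (twoRegular z z∈)))
                (≤-trans (valency≤degree (e ∷ edges p) C z used) (≤-reflexive (degree-start p z≢x))))
              λ { (s≤s ()) }
              where
              used : ∀ {f} → f ∈ E C → Incident S f z → f ∈ˡ e ∷ edges p
              used {f} f∈ inc = decidable-stable (f ∈ˡ? _) λ f∉ → none (f , f∈ , inc , f∉)
      ...   | yes (g , g∈ , inc , g∉) with z′ , jg ← incident⇒joins inc with k
      -- `k` is fuel, with at least `m - k` edges already on the path. At zero the path has `m`
      -- distinct edges, and `e` and `g` would be two more.
      ...     | zero = contradiction
                (≤-trans (unique⇒length≤ u (λ _ → ∈-allFin _)) (≤-reflexive (length-tabulate (λ i → i))))
                (≤⇒≯ (≤-trans m≤ (≤-trans (≤-reflexive (+-identityʳ _)) (n≤1+n _))))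
                where
                u : Unique (g ∷ e ∷ edges p)
                u = ∉⇒unique-∷ g∉ (∉⇒unique-∷ e∉ (edges-unique p))
      ...     | suc k = prolong k (step g (joins-sym jg) p z′∉) (proj₂ (joins-closed isSubgraph g∈ jg))
                (∷⊆ g∈ p⊆) (λ { (here refl) → g∉ (here refl) ; (there e∈p) → e∉ e∈p })
                (≤-trans m≤ (≤-reflexive (+-suc _ k)))
                where
                z′∉ : z′ ∉ˡ verts p
                z′∉ z′∈ = contradiction
                  (≤-trans (≤-reflexive (sym (degree-back p jg z′∈)))
                    (degree≤2 (proj₂ (joins-closed isSubgraph g∈ jg))
                      (∉⇒unique-∷ g∉ (∉⇒unique-∷ e∉ (edges-unique p))) (∷⊆ g∈ (∷⊆ e∈ p⊆))))
                  λ { (s≤s (s≤s ())) }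

      incident-δ : ∀ {f z} → Incident S f z → 1 ≤ δ (S.end₁ f) z + δ (S.end₂ f) z
      incident-δ {f} (inj₁ refl) rewrite δ-refl (S.end₁ f) = s≤s z≤n
      incident-δ {f} (inj₂ refl) rewrite δ-refl (S.end₂ f) = m≤n+m 1 _

    -- The closed path exhausts `C`: each of its vertices already has both its edge ends on it, so
    -- no further edge of `C` touches it, and connectedness of `C` leaves nothing outside.
    circle⇒traversal : Traversal C e x y
    circle⇒traversal
      with q , q⊆ , e∉ ← prolong m (stop y) (proj₁ (joins-closed isSubgraph e∈ j)) (λ ()) (λ ()) ≤-refl = record
      { path = q ; closes = j ; fresh = e∉
      ; ∈V⇒ = λ z∈ → spread (start∈verts q) (proj₂ connected _ _ (proj₂ (joins-closed isSubgraph e∈ j)) z∈)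
      ; ⇒∈V = ⇒V q q⊆
      ; ∈E⇒ = λ f∈ → exhausted
          (spread (start∈verts q) (proj₂ connected _ _ (proj₂ (joins-closed isSubgraph e∈ j))
            (proj₁ (IsSubgraph.closed isSubgraph f∈)))) f∈ (inj₁ refl)
      ; ⇒∈E = ∷⊆ e∈ q⊆ }
      where
      ⇒V : ∀ {a z} (p : Path a y) → (∀ {f} → f ∈ˡ edges p → f ∈ E C) → z ∈ˡ verts p → z ∈ V C
      ⇒V (stop _) _ (here refl) = proj₁ (joins-closed isSubgraph e∈ j)
      ⇒V (step _ jf _ _) p⊆ (here refl) = proj₁ (joins-closed isSubgraph (p⊆ (here refl)) jf)
      ⇒V (step _ _ p _) p⊆ (there z∈) = ⇒V p (p⊆ ∘ there) z∈

      exhausted : ∀ {f z} → z ∈ˡ verts q → f ∈ E C → Incident S f z → f ∈ˡ e ∷ edges q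
      exhausted {f} {z} z∈ f∈ inc = decidable-stable (f ∈ˡ? _) λ f∉ → contradiction
        (≤-trans (≤-trans
          (+-mono-≤ (incident-δ inc)
            (≤-reflexive (sym (trans (closed-degree q j z) (cong (2 *_) (multiplicity-∈ q z∈))))))
          (≤-reflexive (sym (degree-∷ f (e ∷ edges q) z))))
          (degree≤2 (⇒V q q⊆ z∈) (∉⇒unique-∷ f∉ (∉⇒unique-∷ e∉ (edges-unique q))) (∷⊆ f∈ (∷⊆ e∈ q⊆))))
        λ { (s≤s (s≤s ())) }

      spread : ∀ {z z′} → z ∈ˡ verts q → Reachable S C z z′ → z′ ∈ˡ verts q
      spread z∈ ε = z∈
      spread z∈ ((f , f∈ , jf) ◅ r) with exhausted z∈ f∈ (joins⇒incidentˡ jf)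
      ... | there f∈q = spread (incident⇒∈verts q f∈q (joins⇒incidentˡ (joins-sym jf))) r
      ... | here refl with joins-incident j (joins⇒incidentˡ (joins-sym jf))
      ...   | inj₁ refl = spread (finish∈verts q) r
      ...   | inj₂ refl = spread (start∈verts q) r

  -- Signs of circles

  signProduct : List (Fin m) → Sign
  signProduct es = foldr Sign._*_ Sign.+ (map S.σ es)

  signProduct-↭ : ∀ {es fs} → es ↭ fs → signProduct es ≡ signProduct fs
  signProduct-↭ es↭fs =
    foldr-commMonoid (setoid Sign) Sign.*-isCommutativeMonoid (↭⇒↭ₛ (map⁺ S.σ es↭fs))

  signProduct-++ : ∀ es fs → signProduct (es ++ fs) ≡ signProduct es Sign.* signProduct fs
  signProduct-++ [] fs = refl
  signProduct-++ (e ∷ es) fs =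
    trans (cong (S.σ e Sign.*_) (signProduct-++ es fs)) (sym (Sign.*-assoc (S.σ e) _ _))

  -- `signOf` multiplies in the order of the edge names, the right side in the order of the circle.
  -- Both lists enumerate the same set without repetition, hence are permutations of each other, and
  -- signs commute.
  signOf-traversal : ∀ {C e x y} (t : Traversal C e x y) →
                     signOf S C ≡ signProduct (e ∷ edges (Traversal.path t))
  signOf-traversal {C} t = signProduct-↭ $ ∼bag⇒↭ $
    unique∧set⇒bag (filter⁺ (_∈? E C) (allFin⁺ m)) edges-unique′ $ mk⇔
      (λ f∈ → ∈E⇒ (proj₂ (∈-filter⁻ (_∈? E C) {xs = allFin m} f∈)))
      (λ f∈ → ∈-filter⁺ (_∈? E C) (∈-allFin _) (⇒∈E f∈))
    where open Traversal t

  circle-incident : ∀ {C x} → IsCircle S C → x ∈ V C → ∃[ e ] (e ∈ E C × Incident S e x)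
  circle-incident {C} {x} circle x∈ with any? (λ e → (e ∈? E C) ×-dec incident? S e x)
  ... | yes found = found
  ... | no none = contradiction
          (≤-trans (≤-reflexive (sym (IsCircle.twoRegular circle x x∈)))
            (valency≤degree [] C x (λ f∈ inc → contradiction (_ , f∈ , inc) none)))
          λ ()

  -- Surgery on paths

  verts-cases : ∀ {x y z} (p : Path x y) → z ∈ˡ verts p →
                z ≡ x ⊎ (∃[ e ] (e ∈ˡ edges p × Incident S e z))
  verts-cases (stop _) (here refl) = inj₁ refl
  verts-cases (step _ _ _ _) (here refl) = inj₁ refl
  verts-cases (step e j p _) (there z∈) with verts-cases p z∈
  ... | inj₁ refl = inj₂ (e , here refl , joins⇒incidentˡ (joins-sym j))
  ... | inj₂ (f , f∈ , inc) = inj₂ (f , there f∈ , inc)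

  incident-closed : ∀ {H e x} → IsSubgraph S H → e ∈ E H → Incident S e x → x ∈ V H
  incident-closed sub e∈ (inj₁ refl) = proj₁ (IsSubgraph.closed sub e∈)
  incident-closed sub e∈ (inj₂ refl) = proj₂ (IsSubgraph.closed sub e∈)

  append : ∀ {x y z} (p : Path x y) (q : Path y z) →
           (∀ {w} → w ∈ˡ verts p → w ∈ˡ verts q → w ≡ y) →
           Σ[ r ∈ Path x z ] (edges r ≡ edges p ++ edges q ×
                              (∀ {w} → w ∈ˡ verts r → w ∈ˡ verts p ⊎ w ∈ˡ verts q))
  append (stop _) q _ = q , refl , inj₂
  append {x} (step e j p x∉) q disjoint
    with r , eq , r⊆ ← append p q (disjoint ∘ there) =
    step e j r x∉r , cong (e ∷_) eq ,
      λ { (here refl) → inj₁ (here refl) ; (there w∈) → Sum.map₁ there (r⊆ w∈) }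
    where
    x∉r : x ∉ˡ verts r
    x∉r x∈ with r⊆ x∈
    ... | inj₁ x∈p = x∉ x∈p
    ... | inj₂ x∈q with refl ← disjoint (here refl) x∈q = x∉ (finish∈verts p)

  -- The edges are tracked only up to permutation, which is all that membership and the product of
  -- signs depend on.
  reversePath : ∀ {x y} (p : Path x y) →
                Σ[ r ∈ Path y x ] (edges r ↭ edges p × (∀ {w} → w ∈ˡ verts r → w ∈ˡ verts p))
  reversePath (stop x) = stop x , ↭-refl , λ w∈ → w∈
  reversePath (step {x} {x′} e j p x∉)
    with r , r↭p , r⊆ ← reversePath p
    with s , eq , s⊆ ← append r (step e (joins-sym j) (stop x)
                                  λ { (here refl) → x∉ (start∈verts p) })
                         (λ { _ (here refl) → refl ; w∈ (there (here refl)) → contradiction (r⊆ w∈) x∉ }) =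
    s , ↭-trans (↭-reflexive eq) (↭-trans (↭-sym (∷↭∷ʳ e (edges r))) (↭-prep e r↭p)) ,
    λ w∈ → [ there ∘ r⊆ , (λ { (here refl) → there (start∈verts p) ; (there (here refl)) → here refl }) ]′
             (s⊆ w∈)

  record Split {x y} (p : Path x y) (w : Fin n) : Set where
    field
      before   : Path x w
      after    : Path w y
      edges-≡  : edges p ≡ edges before ++ edges after
      before⊆  : ∀ {z} → z ∈ˡ verts before → z ∈ˡ verts p
      after⊆   : ∀ {z} → z ∈ˡ verts after → z ∈ˡ verts p
      disjoint : ∀ {z} → z ∈ˡ verts before → z ∈ˡ verts after → z ≡ w

  split : ∀ {x y w} (p : Path x y) → w ∈ˡ verts p → Split p w
  split (stop x) (here refl) = record
    { before = stop x ; after = stop x ; edges-≡ = refl ; before⊆ = λ z∈ → z∈ ; after⊆ = λ z∈ → z∈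
    ; disjoint = λ { (here refl) _ → refl } }
  split {x} p@(step _ _ _ _) (here refl) = record
    { before = stop x ; after = p ; edges-≡ = refl
    ; before⊆ = λ { (here refl) → here refl } ; after⊆ = λ z∈ → z∈
    ; disjoint = λ { (here refl) _ → refl } }
  split (step e j p x∉) (there w∈) = record
    { before = step e j before (x∉ ∘ before⊆) ; after = after ; edges-≡ = cong (e ∷_) edges-≡
    ; before⊆ = λ { (here refl) → here refl ; (there z∈) → there (before⊆ z∈) }
    ; after⊆ = there ∘ after⊆
    ; disjoint = λ { (here refl) z∈ → contradiction (after⊆ z∈) x∉ ; (there z∈) → disjoint z∈ } }
    where open Split (split p w∈)

  -- The loop-erased walk, cut off where it first meets P.
  firstHit : ∀ {H x z} (P : Subset n) → Reachable S H x z → z ∈ P →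
             ∃[ t ] Σ[ p ∈ Path x t ] (t ∈ P × (∀ {w} → w ∈ˡ verts p → w ∈ P → w ≡ t)
                                             × (∀ {e} → e ∈ˡ edges p → e ∈ E H))
  firstHit {x = x} P ε x∈ = x , stop x , x∈ , (λ { (here refl) _ → refl }) , λ ()
  firstHit {H} {x} P ((e , e∈ , j) ◅ r) z∈
    with t , p , t∈ , only , p⊆ ← firstHit {H} P r z∈
    with x ∈? P
  ... | yes x∈ = x , stop x , x∈ , (λ { (here refl) _ → refl }) , λ ()
  ... | no x∉ with x ∈ˡ? verts p
  ...   | no x∉p = t , step e j p x∉p , t∈
                 , (λ { (here refl) w∈P → contradiction w∈P x∉ ; (there w∈) → only w∈ })
                 , (λ { (here refl) → e∈ ; (there f∈) → p⊆ f∈ })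
  ...   | yes x∈p = t , after , t∈ , only ∘ after⊆
                  , λ f∈ → p⊆ (subst (_ ∈ˡ_) (sym edges-≡) (∈-++⁺ʳ (edges before) f∈))
    where open Split (split p x∈p)

  -- Deleting a vertex

  module _ {H : Part n m} {x : Fin n} where
    ∈-delete⁻ : ∀ {z} → z ∈ V (deleteVertex S H x) → z ∈ V H × z ≢ x
    ∈-delete⁻ z∈ = p─q⊆p (V H) ⁅ x ⁆ z∈ , λ { refl → x∈p─q⇒x∉q (V H) z∈ (x∈⁅x⁆ _) }

    ∈E-delete⁺ : ∀ {e} → e ∈ E H → ¬ Incident S e x → e ∈ E (deleteVertex S H x)
    ∈E-delete⁺ {e} e∈ away = x∈p∩q⁺ (e∈ , lookup⇒[]= e _
      (trans (lookup∘tabulate _ e) (cong not (dec-false (incident? S e x) away))))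

    ∈E-delete⁻ : ∀ {e} → e ∈ E (deleteVertex S H x) → e ∈ E H × ¬ Incident S e x
    ∈E-delete⁻ {e} e∈ with e∈H , away ← x∈p∩q⁻ (E H) (edgesAwayFrom S x) e∈ =
      e∈H , λ inc → contradiction
        (trans (sym (cong not (dec-true (incident? S e x) inc)))
          (trans (sym (lookup∘tabulate _ e)) ([]=⇒lookup away)))
        λ ()

  -- The vertex `x` may lie outside `H`, where deleting it removes no edge of `H`. This case occurs
  -- for a union of two parts, since the vertex deleted from the union may belong to only one of
  -- them.
  inseparable-avoids : ∀ {H x y z} → IsInseparable S H → y ∈ V H → z ∈ V H → y ≢ x → z ≢ x →
                       ¬ ¬ Reachable S (deleteVertex S H x) y z
  inseparable-avoids {H} {x} {y} {z} ins y∈ z∈ y≢x z≢x with x ∈? V H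
  ... | yes x∈ = λ none → IsInseparable.noCutpoint ins x (x∈ , inj₁
          (y , z , x∈p∧x≢y⇒x∈p-y y∈ y≢x , x∈p∧x≢y⇒x∈p-y z∈ z≢x
          , proj₂ (IsInseparable.connected ins) y z y∈ z∈ , none))
  ... | no x∉ = λ none → none (Star.map
          (λ { (e , e∈ , j) → e , ∈E-delete⁺ {H} e∈
                 (λ inc → x∉ (incident-closed (IsInseparable.isSubgraph ins) e∈ inc)) , j })
          (proj₂ (IsInseparable.connected ins) y z y∈ z∈))

  -- Rerouting a negative circle through a given edge

  cycle : ∀ {u w} → Fin m → Path u w → Part n m
  cycle f r = part (fromList (verts r)) (fromList (f ∷ edges r))

  module _ {H : Part n m} (sub : IsSubgraph S H) {f u w} (r : Path u w)
           (f∈ : f ∈ E H) (r⊆ : ∀ {e} → e ∈ˡ edges r → e ∈ E H)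
           (j : Joins S f w u) (f∉ : f ∉ˡ edges r) where

    cycle⊑ : cycle f r ⊑ H
    cycle⊑ = V⊆ ∘ ∈-fromList⁻ (verts r)
           , λ e∈ → E⊆ (∈-fromList⁻ (f ∷ edges r) e∈)
      where
      E⊆ : ∀ {e} → e ∈ˡ f ∷ edges r → e ∈ E H
      E⊆ (here refl) = f∈
      E⊆ (there e∈) = r⊆ e∈

      V⊆ : ∀ {z} → z ∈ˡ verts r → z ∈ V H
      V⊆ z∈ with verts-cases r z∈
      ... | inj₁ refl = proj₂ (joins-closed sub f∈ j)
      ... | inj₂ (e , e∈ , inc) = incident-closed sub (r⊆ e∈) inc

    cycle-traversal : Traversal (cycle f r) f u w
    cycle-traversal = record
      { path = r ; closes = j ; fresh = f∉
      ; ∈V⇒ = ∈-fromList⁻ (verts r) ; ⇒∈V = ∈-fromList⁺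
      ; ∈E⇒ = ∈-fromList⁻ (f ∷ edges r) ; ⇒∈E = ∈-fromList⁺ }

    cycle-circle : IsCircle S (cycle f r)
    cycle-circle = traversal⇒circle
      (IsSubgraph.V⊆ sub ∘ proj₁ cycle⊑ , IsSubgraph.E⊆ sub ∘ proj₂ cycle⊑) cycle-traversal

  -- Here `s` is the sign of the ear, `b` that of one arc of the circle, and `a` with `d` make up
  -- the other arc. In the product of the two candidate signs `s` cancels and the sign of the circle
  -- remains, so exactly one candidate is negative.
  theta-sign : ∀ s a b d → d Sign.* (a Sign.* b) ≡ Sign.- →
               s Sign.* b ≡ Sign.- ⊎ s Sign.* (a Sign.* d) ≡ Sign.-
  theta-sign Sign.- _ Sign.+ _ _ = inj₁ refl
  theta-sign Sign.+ _ Sign.- _ _ = inj₁ refl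
  theta-sign Sign.+ Sign.+ Sign.+ Sign.- _ = inj₂ refl
  theta-sign Sign.+ Sign.- Sign.+ Sign.+ _ = inj₂ refl
  theta-sign Sign.- Sign.+ Sign.- Sign.+ _ = inj₂ refl
  theta-sign Sign.- Sign.- Sign.- Sign.- _ = inj₂ refl

  -- The circles r and s close up the ear, f followed by p, with either arc of D.
  negative-ear : ∀ {H D f w u} → IsInseparable S H → IsCircle S D → D ⊑ H → Negative S D →
                 w ∈ V D → f ∈ E H → f ∉ E D → Joins S f w u → w ≢ u →
                 ¬ ¬ (∃[ D′ ] (IsCircle S D′ × D′ ⊑ H × Negative S D′ × f ∈ E D′))
  negative-ear {H} {D} {f} {w} {u} ins circle D⊑H neg w∈ f∈ f∉D jf w≢u none
    with e , e∈ , inc ← circle-incident circle w∈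
    with x , je ← incident⇒joins inc
    with x ≟ w
  -- A loop of `D` at `w`, together with the further edge `f`, makes `w` a cutpoint by the second
  -- clause of `Cutpoint`.
  ... | yes refl = IsInseparable.noCutpoint ins w (proj₁ D⊑H w∈ , inj₂
          (e , f , proj₂ D⊑H e∈ , loop₁ je , loop₂ je , f∈ , (λ { refl → f∉D e∈ }) , joins⇒incidentˡ jf))
          where
          loop₁ : ∀ {e x} → Joins S e x x → S.end₁ e ≡ x
          loop₁ (inj₁ (p , _)) = p
          loop₁ (inj₂ (p , _)) = p
          loop₂ : ∀ {e x} → Joins S e x x → S.end₂ e ≡ x
          loop₂ (inj₁ (_ , q)) = q
          loop₂ (inj₂ (_ , q)) = q
  ... | no x≢w =
    -- The walk from `u` avoids `w` but aims at `x`, a vertex of `D`, so it has a first vertex `t`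
    -- on `D`. As `t` differs from `w`, these two vertices cut `D` into two arcs.
    inseparable-avoids ins (proj₂ (joins-closed sub f∈ jf)) (proj₁ D⊑H x∈D) (w≢u ∘ sym) x≢w λ walk →
      let t , p , t∈ , only , p⊆ = firstHit {deleteVertex S H w} (V D) walk x∈D in theta p t∈ only p⊆
    where
    sub = IsInseparable.isSubgraph ins
    x∈D = proj₂ (joins-closed (IsCircle.isSubgraph circle) e∈ je)
    traversal = circle⇒traversal circle e∈ je
    open Traversal traversal

    theta : ∀ {t} (p : Path u t) → t ∈ V D → (∀ {z} → z ∈ˡ verts p → z ∈ V D → z ≡ t) →
            ¬ (∀ {g} → g ∈ˡ edges p → g ∈ E (deleteVertex S H w))
    theta {t} p t∈ only p⊆ =
      [ (λ neg₁ → positive r r⊆ f∉r (trans sign-r neg₁)) , (λ neg₂ → positive s s⊆ f∉s (trans sign-s neg₂)) ]′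
        (theta-sign (S.σ f Sign.* signProduct (edges p)) (signProduct (edges before))
          (signProduct (edges after)) (S.σ e) (trans (sym sign-D) neg))
      where
      open Split (split path (∈V⇒ t∈))

      w∉p : w ∉ˡ verts p
      w∉p w∈p with verts-cases p w∈p
      ... | inj₁ w≡u = w≢u w≡u
      ... | inj₂ (g , g∈ , inc′) = proj₂ (∈E-delete⁻ {H} (p⊆ g∈)) inc′

      t≢w : t ≢ w
      t≢w refl = w∉p (finish∈verts p)

      f∉p : f ∉ˡ edges p
      f∉p = away⇒∉edges p w∉p (joins⇒incidentˡ jf)

      before⊆E : ∀ {g} → g ∈ˡ edges before → g ∈ E D
      before⊆E g∈ = ⇒∈E (there (subst (_ ∈ˡ_) (sym edges-≡) (∈-++⁺ˡ g∈)))

      after⊆E : ∀ {g} → g ∈ˡ edges after → g ∈ E D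
      after⊆E g∈ = ⇒∈E (there (subst (_ ∈ˡ_) (sym edges-≡) (∈-++⁺ʳ (edges before) g∈)))

      -- The path `p` meets `D` only in `t`, so it joins either arc from `t` to `w` without
      -- repeating a vertex.
      r+ = append p after (λ z∈p z∈a → only z∈p (⇒∈V (after⊆ z∈a)))
      r = proj₁ r+

      r-cases : ∀ {g} → g ∈ˡ edges r → g ∈ˡ edges p ⊎ g ∈ E D
      r-cases g∈ = Sum.map₂ after⊆E (∈-++⁻ (edges p) (subst (_ ∈ˡ_) (proj₁ (proj₂ r+)) g∈))

      back+ = reversePath before
      back = proj₁ back+
      back⊆ = proj₂ (proj₂ back+)

      w∉before : w ∉ˡ verts before
      w∉before w∈b = t≢w (sym (disjoint w∈b (finish∈verts after)))

      -- The other arc from `t` to `w` runs back along `before` to `x` and finishes with `e`.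
      tail+ = append back (step e (joins-sym je) (stop w) λ { (here refl) → x≢w refl })
                λ { _ (here refl) → refl ; z∈ (there (here refl)) → contradiction (back⊆ z∈) w∉before }
      tail = proj₁ tail+

      tail⊆V : ∀ {z} → z ∈ˡ verts tail → z ∈ V D
      tail⊆V z∈ with proj₂ (proj₂ tail+) z∈
      ... | inj₁ z∈b = ⇒∈V (before⊆ (back⊆ z∈b))
      ... | inj₂ (here refl) = x∈D
      ... | inj₂ (there (here refl)) = w∈

      tail⊆E : ∀ {g} → g ∈ˡ edges tail → g ∈ E D
      tail⊆E g∈ with ∈-++⁻ (edges back) (subst (_ ∈ˡ_) (proj₁ (proj₂ tail+)) g∈)
      ... | inj₁ g∈b = before⊆E (∈-resp-↭ (proj₁ (proj₂ back+)) g∈b)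
      ... | inj₂ (here refl) = e∈

      s+ = append p tail (λ z∈p z∈t → only z∈p (tail⊆V z∈t))
      s = proj₁ s+

      s-cases : ∀ {g} → g ∈ˡ edges s → g ∈ˡ edges p ⊎ g ∈ E D
      s-cases g∈ = Sum.map₂ tail⊆E (∈-++⁻ (edges p) (subst (_ ∈ˡ_) (proj₁ (proj₂ s+)) g∈))

      either⊆ : ∀ {g} → g ∈ˡ edges p ⊎ g ∈ E D → g ∈ E H
      either⊆ = [ (λ g∈ → proj₁ (∈E-delete⁻ {H} (p⊆ g∈))) , proj₂ D⊑H ]′

      r⊆ : ∀ {g} → g ∈ˡ edges r → g ∈ E H
      r⊆ = either⊆ ∘ r-cases

      s⊆ : ∀ {g} → g ∈ˡ edges s → g ∈ E H
      s⊆ = either⊆ ∘ s-cases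

      f∉r : f ∉ˡ edges r
      f∉r = [ f∉p , f∉D ]′ ∘ r-cases

      f∉s : f ∉ˡ edges s
      f∉s = [ f∉p , f∉D ]′ ∘ s-cases

      sign-D : signOf S D ≡
               S.σ e Sign.* (signProduct (edges before) Sign.* signProduct (edges after))
      sign-D = trans (signOf-traversal traversal)
        (cong (S.σ e Sign.*_) (trans (cong signProduct edges-≡) (signProduct-++ (edges before) _)))

      sign-r : signProduct (f ∷ edges r) ≡
               (S.σ f Sign.* signProduct (edges p)) Sign.* signProduct (edges after)
      sign-r = trans
        (cong (S.σ f Sign.*_) (trans (cong signProduct (proj₁ (proj₂ r+))) (signProduct-++ (edges p) _)))
        (sym (Sign.*-assoc (S.σ f) _ _))

      sign-tail : signProduct (edges tail) ≡ signProduct (edges before) Sign.* S.σ e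
      sign-tail = trans (cong signProduct (proj₁ (proj₂ tail+)))
        (trans (signProduct-++ (edges back) (e ∷ []))
          (cong₂ Sign._*_ (signProduct-↭ (proj₁ (proj₂ back+))) (Sign.*-identityʳ (S.σ e))))

      sign-s : signProduct (f ∷ edges s) ≡ (S.σ f Sign.* signProduct (edges p))
               Sign.* (signProduct (edges before) Sign.* S.σ e)
      sign-s = trans
        (cong (S.σ f Sign.*_) (trans (cong signProduct (proj₁ (proj₂ s+)))
          (trans (signProduct-++ (edges p) _) (cong (signProduct (edges p) Sign.*_) sign-tail))))
        (sym (Sign.*-assoc (S.σ f) _ _))

      positive : (q : Path u w) → (∀ {g} → g ∈ˡ edges q → g ∈ E H) → f ∉ˡ edges q →
                 signProduct (f ∷ edges q) ≢ Sign.-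
      positive q q⊆ f∉q neg′ = none
        ( cycle f q , cycle-circle sub q f∈ q⊆ jf f∉q , cycle⊑ sub q f∈ q⊆ jf f∉q
        , trans (signOf-traversal (cycle-traversal sub q f∈ q⊆ jf f∉q)) neg′
        , ∈-fromList⁺ {xs = f ∷ edges q} (here refl) )

  -- Negative circles in an unbalanced inseparable part

  NegativeCircleThrough : Part n m → Fin n → Set
  NegativeCircleThrough H x = ∃[ D ] (IsCircle S D × D ⊑ H × Negative S D × x ∈ V D)

  -- Induction on the walk, one edge `f` at a time. If `f` lies on the circle, so does its other
  -- end; if `f` is a loop, the vertex is unchanged; otherwise the circle is rerouted through `f`
  -- and then contains both its ends.
  negative-circle-spreads : ∀ {H x y} → IsInseparable S H → Reachable S H x y →
                            NegativeCircleThrough H x → ¬ ¬ NegativeCircleThrough H y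
  negative-circle-spreads ins ε found none = none found
  negative-circle-spreads {x = x} ins (_◅_ {j = x′} (f , f∈ , j) r) (D , circle , D⊑ , neg , x∈) none
    with f ∈? E D | x ≟ x′
  ... | yes f∈D | _ = negative-circle-spreads ins r
          (D , circle , D⊑ , neg , proj₂ (joins-closed (IsCircle.isSubgraph circle) f∈D j)) none
  ... | no _ | yes refl = negative-circle-spreads ins r (D , circle , D⊑ , neg , x∈) none
  ... | no f∉D | no x≢x′ = negative-ear ins circle D⊑ neg x∈ f∈ f∉D j x≢x′
          λ { (D′ , circle′ , D′⊑ , neg′ , f∈D′) → negative-circle-spreads ins r
              (D′ , circle′ , D′⊑ , neg′ , proj₂ (joins-closed (IsCircle.isSubgraph circle′) f∈D′ j)) none }

  unbalanced⇒negative-circle : ∀ {H x} → IsInseparable S H → Unbalanced S H → x ∈ V H →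
                               ¬ ¬ NegativeCircleThrough H x
  unbalanced⇒negative-circle {H} {x} ins unbalanced x∈ none = unbalanced positive
    where
    positive : Balanced S H
    positive D circle D⊑ with signOf S D in eq
    ... | Sign.+ = refl
    ... | Sign.- with z , z∈ ← proj₁ (IsCircle.connected circle) =
      contradiction none (negative-circle-spreads ins
        (proj₂ (IsInseparable.connected ins) z x (proj₁ D⊑ z∈) x∈) (D , circle , D⊑ , eq , z∈))

  -- Circles are inseparable

  private
    -- When the circle is cut open at an edge ending in `x`, this vertex is the start of the path.
    -- Deleting it leaves the path after its first step, which is connected.
    traversal-connects : ∀ {C e x y} → Traversal C e x y → ∀ {z z′} →
                         z ∈ V (deleteVertex S C x) → z′ ∈ V (deleteVertex S C x) →
                         Reachable S (deleteVertex S C x) z z′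
    traversal-connects {C} record { path = stop x ; ∈V⇒ = ∈V⇒ } z∈ _
      with z∈C , z≢x ← ∈-delete⁻ {C} z∈ with here z≡x ← ∈V⇒ z∈C = contradiction z≡x z≢x
    traversal-connects {C} {x = x} record { path = step {x′ = x′} g j p x∉ ; ∈V⇒ = ∈V⇒ ; ⇒∈E = ⇒∈E } z∈ z′∈ =
      reachable-sym {deleteVertex S C x} (from-start z∈) ◅◅ from-start z′∈
      where
      from-start : ∀ {z} → z ∈ V (deleteVertex S C x) → Reachable S (deleteVertex S C x) x′ z
      from-start z∈ with z∈C , z≢x ← ∈-delete⁻ {C} z∈ with ∈V⇒ z∈C
      ... | here z≡x = contradiction z≡x z≢x
      ... | there z∈p = path-reachable (deleteVertex S C x) p
              (λ f∈ → ∈E-delete⁺ {C} (⇒∈E (there (there f∈))) λ inc → away⇒∉edges p x∉ inc f∈) z∈p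

    loop-traversal : ∀ {C e f x} → Traversal C e x x → f ∈ E C → f ≡ e
    loop-traversal record { path = stop _ ; ∈E⇒ = ∈E⇒ } f∈ with here f≡e ← ∈E⇒ f∈ = f≡e
    loop-traversal record { path = step _ _ p x∉ } _ = contradiction (finish∈verts p) x∉

  circle⇒inseparable : ∀ {C} → IsCircle S C → IsInseparable S C
  circle⇒inseparable {C} circle = record
    { isSubgraph = isSubgraph ; connected = connected ; noCutpoint = noCutpoint }
    where
    open IsCircle circle
    noCutpoint : ∀ x → ¬ Cutpoint S C x
    noCutpoint x (x∈ , inj₁ (y , z , y∈ , z∈ , _ , none))
      with e , e∈ , inc ← circle-incident circle x∈
      with x′ , j ← incident⇒joins inc =
      none (traversal-connects (circle⇒traversal circle e∈ (joins-sym j)) y∈ z∈)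
    noCutpoint x (x∈ , inj₂ (e , f , e∈ , p , q , f∈ , f≢e , _)) =
      f≢e (loop-traversal (circle⇒traversal circle e∈ (inj₁ (p , q))) f∈)

  -- Unions of inseparable parts, and blocks

  ⊑-refl : {H : Part n m} → H ⊑ H
  ⊑-refl = (λ x∈ → x∈) , λ e∈ → e∈

  ⊑-trans : {H K L : Part n m} → H ⊑ K → K ⊑ L → H ⊑ L
  ⊑-trans (V⊆ , E⊆) (V⊆′ , E⊆′) = V⊆′ ∘ V⊆ , E⊆′ ∘ E⊆

  reachable-mono : ∀ {H K} → E H ⊆ E K → ∀ {x y} → Reachable S H x y → Reachable S K x y
  reachable-mono H⊆K = Star.map λ { (e , e∈ , j) → e , H⊆K e∈ , j }

  delete-mono : ∀ {H K x} → E H ⊆ E K → E (deleteVertex S H x) ⊆ E (deleteVertex S K x)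
  delete-mono {H} {K} H⊆K e∈ with e∈H , away ← ∈E-delete⁻ {H} e∈ = ∈E-delete⁺ {K} (H⊆K e∈H) away

  leaving-edge : ∀ {H x y} → Reachable S H x y → x ≢ y →
                 ∃[ e ] ∃[ z ] (e ∈ E H × Joins S e x z × z ≢ x)
  leaving-edge ε x≢y = contradiction refl x≢y
  leaving-edge {H} {x} (_◅_ {j = z} (e , e∈ , j) r) x≢y with z ≟ x
  ... | yes refl = leaving-edge {H} r x≢y
  ... | no z≢x = e , z , e∈ , j , z≢x

  other-vertex : ∀ {a b} → a ≢ b → {P : Fin n → Set} → P a → P b → ∀ x → ∃[ c ] (P c × c ≢ x)
  other-vertex {a} {b} a≢b pa pb x with a ≟ x
  ... | yes refl = b , pb , a≢b ∘ sym
  ... | no a≢x = a , pa , a≢x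

  -- With a second vertex present, connectedness provides an edge leaving `x`. Beside a loop at `x`
  -- this edge would make `x` a cutpoint.
  inseparable⇒noLoop : ∀ {H a b} → IsInseparable S H → a ∈ V H → b ∈ V H → a ≢ b →
                       ∀ x → NoLoopAt S H x
  inseparable⇒noLoop {H} ins a∈ b∈ a≢b x e e∈ (p , q)
    with x∈ ← incident-closed (IsInseparable.isSubgraph ins) e∈ (inj₁ p)
    with c , c∈ , c≢x ← other-vertex a≢b {_∈ V H} a∈ b∈ x
    with f , z , f∈ , j , z≢x ← leaving-edge {H} (proj₂ (IsInseparable.connected ins) x c x∈ c∈) (c≢x ∘ sym) =
    IsInseparable.noCutpoint ins x
      (x∈ , inj₂ (e , f , e∈ , p , q , f∈ , (λ { refl → not-loop j }) , joins⇒incidentˡ j))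
    where
    not-loop : ¬ Joins S e x z
    not-loop (inj₁ (_ , q′)) = z≢x (trans (sym q′) q)
    not-loop (inj₂ (p′ , _)) = z≢x (trans (sym p′) p)

  infixr 6 _⊔_

  _⊔_ : Part n m → Part n m → Part n m
  H ⊔ K = part (V H ∪ V K) (E H ∪ E K)

  ⊑-⊔ˡ : ∀ {H K} → H ⊑ H ⊔ K
  ⊑-⊔ˡ = x∈p∪q⁺ ∘ inj₁ , x∈p∪q⁺ ∘ inj₁

  ⊑-⊔ʳ : ∀ {H K} → K ⊑ H ⊔ K
  ⊑-⊔ʳ = x∈p∪q⁺ ∘ inj₂ , x∈p∪q⁺ ∘ inj₂

  -- Whichever vertex is deleted, one of `a` and `b` survives, and every remaining vertex reaches
  -- the survivor inside its own part. The loop clause of `Cutpoint` cannot apply, since both parts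
  -- have two vertices and hence no loops.
  ⊔-inseparable : ∀ {H K a b} → IsInseparable S H → IsInseparable S K →
                  a ∈ V H × a ∈ V K → b ∈ V H × b ∈ V K → a ≢ b → IsInseparable S (H ⊔ K)
  ⊔-inseparable {H} {K} {a} {b} insH insK a∈ b∈ a≢b = record
    { isSubgraph = record
      { V⊆ = [ IsSubgraph.V⊆ H.isSubgraph , IsSubgraph.V⊆ K.isSubgraph ]′ ∘ x∈p∪q⁻ (V H) (V K)
      ; E⊆ = [ IsSubgraph.E⊆ H.isSubgraph , IsSubgraph.E⊆ K.isSubgraph ]′ ∘ x∈p∪q⁻ (E H) (E K)
      ; closed = λ e∈ →
          [ (λ e∈H → let p , q = IsSubgraph.closed H.isSubgraph e∈H in x∈p∪q⁺ (inj₁ p) , x∈p∪q⁺ (inj₁ q))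
          , (λ e∈K → let p , q = IsSubgraph.closed K.isSubgraph e∈K in x∈p∪q⁺ (inj₂ p) , x∈p∪q⁺ (inj₂ q))
          ]′ (x∈p∪q⁻ (E H) (E K) e∈) }
    ; connected = (a , x∈p∪q⁺ (inj₁ (proj₁ a∈))) ,
        λ y z y∈ z∈ → reachable-sym {H ⊔ K} (from-a y∈) ◅◅ from-a z∈
    ; noCutpoint = noCutpoint }
    where
    module H = IsInseparable insH
    module K = IsInseparable insK

    from-a : ∀ {z} → z ∈ V (H ⊔ K) → Reachable S (H ⊔ K) a z
    from-a z∈ with x∈p∪q⁻ (V H) (V K) z∈
    ... | inj₁ z∈H = reachable-mono {H} {H ⊔ K} (proj₂ (⊑-⊔ˡ {H} {K})) (proj₂ H.connected a _ (proj₁ a∈) z∈H)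
    ... | inj₂ z∈K = reachable-mono {K} {H ⊔ K} (proj₂ (⊑-⊔ʳ {H} {K})) (proj₂ K.connected a _ (proj₂ a∈) z∈K)

    avoiding : ∀ {x y c} → y ∈ V (H ⊔ K) → c ∈ V H × c ∈ V K → y ≢ x → c ≢ x →
               ¬ ¬ Reachable S (deleteVertex S (H ⊔ K) x) y c
    avoiding {x} y∈ (c∈H , c∈K) y≢x c≢x none with x∈p∪q⁻ (V H) (V K) y∈
    ... | inj₁ y∈H = inseparable-avoids insH y∈H c∈H y≢x c≢x
            (none ∘ reachable-mono {deleteVertex S H x} {deleteVertex S (H ⊔ K) x}
              (delete-mono {H} {H ⊔ K} (proj₂ (⊑-⊔ˡ {H} {K}))))
    ... | inj₂ y∈K = inseparable-avoids insK y∈K c∈K y≢x c≢x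
            (none ∘ reachable-mono {deleteVertex S K x} {deleteVertex S (H ⊔ K) x}
              (delete-mono {K} {H ⊔ K} (proj₂ (⊑-⊔ʳ {H} {K}))))

    noCutpoint : ∀ x → ¬ Cutpoint S (H ⊔ K) x
    noCutpoint x (_ , inj₁ (y , z , y∈ , z∈ , _ , none))
      with c , c∈ , c≢x ← other-vertex a≢b {λ c → c ∈ V H × c ∈ V K} a∈ b∈ x
      with y∈U , y≢x ← ∈-delete⁻ {H ⊔ K} y∈
      with z∈U , z≢x ← ∈-delete⁻ {H ⊔ K} z∈ =
      avoiding y∈U c∈ y≢x c≢x λ y⇝c → avoiding z∈U c∈ z≢x c≢x λ z⇝c →
        none (y⇝c ◅◅ reachable-sym {deleteVertex S (H ⊔ K) x} z⇝c)
    noCutpoint x (_ , inj₂ (e , _ , e∈ , p , q , _)) with x∈p∪q⁻ (E H) (E K) e∈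
    ... | inj₁ e∈H = inseparable⇒noLoop insH (proj₁ a∈) (proj₁ b∈) a≢b x e e∈H (p , q)
    ... | inj₂ e∈K = inseparable⇒noLoop insK (proj₂ a∈) (proj₂ b∈) a≢b x e e∈K (p , q)

  blocks-sharing-two-vertices : ∀ {A B a b} → IsBlock S A → IsBlock S B →
                                a ∈ V A × a ∈ V B → b ∈ V A × b ∈ V B → a ≢ b → A ≡ B
  blocks-sharing-two-vertices {A} {B} blkA blkB a∈ b∈ a≢b = part-≡
    (⊑-trans (⊑-⊔ˡ {A} {B}) (IsBlock.maximal blkB _ union (⊑-⊔ʳ {A} {B})))
    (⊑-trans (⊑-⊔ʳ {A} {B}) (IsBlock.maximal blkA _ union (⊑-⊔ˡ {A} {B})))
    where
    union = ⊔-inseparable (IsBlock.inseparable blkA) (IsBlock.inseparable blkB) a∈ b∈ a≢b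

  infix 4 _⊑?_

  _⊑?_ : (H K : Part n m) → Dec (H ⊑ K)
  H ⊑? K = (V H ⊆? V K) ×-dec (E H ⊆? E K)

  size : Part n m → ℕ
  size H = ∣ V H ∣ + ∣ E H ∣

  size-mono-< : ∀ {H K} → H ⊑ K → ¬ K ⊑ H → size H < size K
  size-mono-< {H} {K} (V⊆ , E⊆) K⋢H with V K ⊆? V H
  ... | no V⊈ = +-mono-<-≤ (p⊂q⇒∣p∣<∣q∣ (⊆∧⊉⇒⊂ V⊆ V⊈)) (p⊆q⇒∣p∣≤∣q∣ E⊆)
  ... | yes V⊇ = +-mono-≤-< (p⊆q⇒∣p∣≤∣q∣ V⊆)
          (p⊂q⇒∣p∣<∣q∣ (⊆∧⊉⇒⊂ E⊆ λ E⊇ → K⋢H (V⊇ , E⊇)))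

  -- Inseparability is not decided here, so there is no search for a block. Instead `H` itself is
  -- proposed; a `K` refuting its maximality is inseparable and strictly larger, and takes its
  -- place. As `size` never exceeds `n + m`, this ends.
  inseparable⇒in-block : ∀ {H} → IsInseparable S H → ¬ ¬ (∃[ A ] (IsBlock S A × H ⊑ A))
  inseparable⇒in-block {H} = grow (n + m) (m≤n+m (n + m) (size H))
    where
    grow : ∀ k {H} → n + m ≤ size H + k → IsInseparable S H → ¬ ¬ (∃[ A ] (IsBlock S A × H ⊑ A))
    grow k {H} bound ins none = none (H , record { inseparable = ins ; maximal = maximal } , ⊑-refl)
      where
      maximal : ∀ K → IsInseparable S K → H ⊑ K → K ⊑ H
      maximal K insK H⊑K = decidable-stable (K ⊑? H) (larger k bound)
        where
        larger : ∀ k → n + m ≤ size H + k → ¬ ¬ K ⊑ H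
        larger zero bound K⋢H = contradiction
          (≤-trans (size-mono-< H⊑K K⋢H) (+-mono-≤ (∣p∣≤n (V K)) (∣p∣≤n (E K))))
          (≤⇒≯ (≤-trans bound (≤-reflexive (+-identityʳ _))))
        larger (suc k) bound K⋢H = grow k
          (≤-trans bound (≤-trans (≤-reflexive (+-suc _ k)) (+-monoˡ-≤ k (size-mono-< H⊑K K⋢H))))
          insK
          λ { (A , blk , K⊑A) → none (A , blk , ⊑-trans H⊑K K⊑A) }

-- Circles through a suppressed vertex

module Suppression {n m : ℕ} (S : SignedGraph n m) {H : Part n m} (sub : IsSubgraph S H)
                   (v : Fin n) (d : deg S H v ≡ 2) (nl : NoLoopAt S H v) where
  private module S = SignedGraph S

  S↓ : SignedGraph n (suc m)
  S↓ = suppress S H sub v d nl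

  private
    -- Obtained by the same call of `asPair` as in `suppress`, so that the ends and the sign of
    -- `zero` unfold to expressions in these two edges.
    f g : Fin m
    f = proj₁ (asPair (incidentEdges S H v) d)
    g = proj₁ (proj₂ (asPair (incidentEdges S H v) d))

    incidentEdges≡ : incidentEdges S H v ≡ f ∷ g ∷ []
    incidentEdges≡ = proj₂ (proj₂ (asPair (incidentEdges S H v) d))

    P? = λ e → (e ∈? E H) ×-dec incident? S e v

    at-v⇒ : ∀ {e} → e ∈ E H → Incident S e v → e ∈ˡ f ∷ g ∷ []
    at-v⇒ e∈ inc = subst (_ ∈ˡ_) incidentEdges≡ (∈-filter⁺ P? (∈-allFin _) (e∈ , inc))

    ⇒at-v : ∀ {e} → e ∈ˡ f ∷ g ∷ [] → e ∈ E H × Incident S e v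
    ⇒at-v e∈ = proj₂ (∈-filter⁻ P? {xs = allFin m} (subst (_ ∈ˡ_) (sym incidentEdges≡) e∈))

    f≢g : f ≢ g
    f≢g f≡g = Unique[x∷xs]⇒x∉xs (subst Unique incidentEdges≡ (filter⁺ P? (allFin⁺ m))) (here f≡g)

    joins-otherEnd : ∀ {e} → Incident S e v → Joins S e v (otherEnd S e v)
    joins-otherEnd {e} inc with S.end₁ e ≟ v
    ... | yes p = inj₁ (p , refl)
    joins-otherEnd {e} (inj₁ p) | no ¬p = contradiction p ¬p
    joins-otherEnd {e} (inj₂ q) | no ¬p = inj₂ (refl , q)

    otherEnd-unique : ∀ {e x} → Joins S e v x → x ≢ v → otherEnd S e v ≡ x
    otherEnd-unique {e} j x≢v with S.end₁ e ≟ v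
    otherEnd-unique (inj₁ (_ , q)) x≢v | yes _ = q
    otherEnd-unique (inj₂ (p , _)) x≢v | yes p′ = contradiction (trans (sym p) p′) x≢v
    otherEnd-unique (inj₁ (p , _)) x≢v | no ¬p = contradiction p ¬p
    otherEnd-unique (inj₂ (p , _)) x≢v | no ¬p = p

    -- In `S↓` the edge `suc e` has by computation the ends of `e`, so `j` is reused as it is. A
    -- `Path` does not ask its edges to belong to the graph, hence no membership has to be carried
    -- along.
    raise : ∀ {x y} (p : Path S x y) →
            Σ[ q ∈ Path S↓ x y ] (verts S↓ q ≡ verts S p × edges S↓ q ≡ map suc (edges S p))
    raise (stop x) = stop x , refl , refl
    raise (step e j p x∉) with q , vs , es ← raise p =
      step (suc e) j q (subst (_ ∉ˡ_) (sym vs) x∉) , cong (_ ∷_) vs , cong (suc e ∷_) es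

    lower : ∀ {x y} (q : Path S↓ x y) → zero ∉ˡ edges S↓ q →
            Σ[ p ∈ Path S x y ] (verts S p ≡ verts S↓ q × edges S↓ q ≡ map suc (edges S p))
    lower (stop x) _ = stop x , refl , refl
    lower (step zero _ _ _) 0∉ = contradiction (here refl) 0∉
    lower (step (suc e) j q x∉) 0∉ with p , vs , es ← lower q (0∉ ∘ there) =
      step e j p (subst (_ ∉ˡ_) (sym vs) x∉) , cong (_ ∷_) vs , cong (suc e ∷_) es

    signProduct-suc : ∀ es → signProduct S↓ (map suc es) ≡ signProduct S es
    signProduct-suc [] = refl
    signProduct-suc (e ∷ es) = cong (S.σ e Sign.*_) (signProduct-suc es)

    f,g⊎g,f : ∀ {e h} → e ∈ˡ f ∷ g ∷ [] → h ∈ˡ f ∷ g ∷ [] → h ≢ e → e ≡ f × h ≡ g ⊎ e ≡ g × h ≡ f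
    f,g⊎g,f (here refl) (here refl) h≢e = contradiction refl h≢e
    f,g⊎g,f (here refl) (there (here refl)) _ = inj₁ (refl , refl)
    f,g⊎g,f (there (here refl)) (here refl) _ = inj₂ (refl , refl)
    f,g⊎g,f (there (here refl)) (there (here refl)) h≢e = contradiction refl h≢e

  -- The last two fields say that the circle uses both edges at `v`. `suppressCircle` forgets these
  -- edges, and its injectivity rests on recovering them.
  record Suppressed (D : Part n m) : Set where
    field
      circle : IsCircle S↓ (suppressCircle S D v)
      sign   : signOf S↓ (suppressCircle S D v) ≡ signOf S D
      f∈     : f ∈ E D
      g∈     : g ∈ E D

  -- Cut open at an edge `e` at `v`, the circle is `e`, then an edge `h` from `v` to `x`, then a
  -- path `p` from `x` to `y` that avoids `v`. The new edge replaces `e` and `h` and closes `p`.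
  -- Which of `e` and `h` is `f` depends on the direction of travel, whence `cases`.
  suppress-circle : ∀ {D} → IsCircle S D → D ⊑ H → v ∈ V D → Suppressed D
  suppress-circle {D} circ D⊑H v∈
    with e , e∈ , inc ← circle-incident S circ v∈
    with y , j ← incident⇒joins S inc = from-traversal (circle⇒traversal S circ e∈ (joins-sym S j))
    where
    no-loop : ∀ {e} → e ∈ E D → ¬ Joins S e v v
    no-loop e∈ (inj₁ ends) = nl _ (proj₂ D⊑H e∈) ends
    no-loop e∈ (inj₂ ends) = nl _ (proj₂ D⊑H e∈) ends

    from-traversal : ∀ {e y} → Traversal S D e v y → Suppressed D
    from-traversal record { path = stop _ ; closes = j ; ⇒∈E = ⇒∈E } =
      contradiction j (no-loop (⇒∈E (here refl)))
    from-traversal {e} {y} t@record { path = step {x′ = x} h jh p v∉ ; closes = j ; fresh = fresh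
                                    ; ∈V⇒ = ∈V⇒ ; ⇒∈V = ⇒∈V ; ∈E⇒ = ∈E⇒ ; ⇒∈E = ⇒∈E }
      with q , vs , es ← raise p = record
      { circle = traversal⇒circle S↓ (V⊆ , E⊆) traversal↓
      ; sign = trans (signOf-traversal S↓ traversal↓) (trans sign-eq (sym (signOf-traversal S t)))
      ; f∈ = [ (λ { (refl , refl) → ⇒∈E (here refl) })
             , (λ { (refl , refl) → ⇒∈E (there (here refl)) }) ]′ cases
      ; g∈ = [ (λ { (refl , refl) → ⇒∈E (there (here refl)) })
             , (λ { (refl , refl) → ⇒∈E (here refl) }) ]′ cases }
      where
      cases : e ≡ f × h ≡ g ⊎ e ≡ g × h ≡ f
      cases = f,g⊎g,f
        (at-v⇒ (proj₂ D⊑H (⇒∈E (here refl))) (joins⇒incidentˡ S (joins-sym S j)))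
        (at-v⇒ (proj₂ D⊑H (⇒∈E (there (here refl)))) (joins⇒incidentˡ S jh))
        λ { refl → fresh (here refl) }

      y≢v : y ≢ v
      y≢v refl = no-loop (⇒∈E (here refl)) j

      x≢v : x ≢ v
      x≢v refl = v∉ (start∈verts S p)

      closes↓ : Joins S↓ zero y x
      closes↓ with cases
      ... | inj₁ (refl , refl) = inj₁ (otherEnd-unique (joins-sym S j) y≢v , otherEnd-unique jh x≢v)
      ... | inj₂ (refl , refl) = inj₂ (otherEnd-unique jh x≢v , otherEnd-unique (joins-sym S j) y≢v)

      E-cases : ∀ {k} → k ∈ E D → ¬ Incident S k v → k ∈ˡ edges S p
      E-cases k∈ away with ∈E⇒ k∈
      ... | here refl = contradiction (joins⇒incidentˡ S (joins-sym S j)) away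
      ... | there (here refl) = contradiction (joins⇒incidentˡ S jh) away
      ... | there (there k∈p) = k∈p

      traversal↓ : Traversal S↓ (suppressCircle S D v) zero x y
      traversal↓ = record
        { path = q ; closes = closes↓
        ; fresh = λ 0∈ → case ∈-map⁻ suc (subst (zero ∈ˡ_) es 0∈) of λ { (_ , _ , ()) }
        ; ∈V⇒ = λ z∈ → let z∈D , z≢v = ∈-delete⁻ S {D} z∈ in
            case ∈V⇒ z∈D of λ { (here z≡v) → contradiction z≡v z≢v
                              ; (there z∈p) → subst (_ ∈ˡ_) (sym vs) z∈p }
        ; ⇒∈V = λ z∈q → let z∈p = subst (_ ∈ˡ_) vs z∈q in
            x∈p∧x≢y⇒x∈p-y (⇒∈V (there z∈p)) λ { refl → v∉ z∈p }
        ; ∈E⇒ = λ { {zero} _ → here refl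
                  ; {suc k} (there k∈) → let k∈D , away = ∈E-delete⁻ S {D} k∈ in
                      there (subst (_ ∈ˡ_) (sym es) (∈-map⁺ suc (E-cases k∈D away))) }
        ; ⇒∈E = λ { (here refl) → here
                  ; (there k∈q) → case ∈-map⁻ suc (subst (_ ∈ˡ_) es k∈q) of
                      λ { (k , k∈p , refl) → there (∈E-delete⁺ S {D} (⇒∈E (there (there k∈p)))
                            λ inc → away⇒∉edges S p v∉ inc k∈p) } } }

      sign-eq : signProduct S↓ (zero ∷ edges S↓ q) ≡ signProduct S (e ∷ h ∷ edges S p)
      sign-eq = trans
        (cong ((S.σ f Sign.* S.σ g) Sign.*_)
          (trans (cong (signProduct S↓) es) (signProduct-suc (edges S p))))
        (trans (cong (Sign._* signProduct S (edges S p)) ends-sign)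
          (Sign.*-assoc (S.σ e) _ _))
        where
        ends-sign : S.σ f Sign.* S.σ g ≡ S.σ e Sign.* S.σ h
        ends-sign with cases
        ... | inj₁ (refl , refl) = refl
        ... | inj₂ (refl , refl) = Sign.*-comm (S.σ f) (S.σ g)

      V⊆ : V D - v ⊆ V H - v
      V⊆ z∈ with z∈D , z≢v ← ∈-delete⁻ S {D} z∈ = x∈p∧x≢y⇒x∈p-y (proj₁ D⊑H z∈D) z≢v

      E⊆ : E (suppressCircle S D v) ⊆ SignedGraph.E S↓
      E⊆ here = here
      E⊆ (there k∈) = there (delete-mono S {D} {H} (proj₂ D⊑H) k∈)

  -- Cut open at `zero`, the circle is a path between the far ends of `g` and `f`. It avoids `v`,
  -- which is no vertex of `S↓`, so `g` prolongs it to `v` and `f` closes it.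
  restore-circle : ∀ {D′} → IsCircle S↓ D′ → zero ∈ E D′ →
                   ∃[ D ] (IsCircle S D × D ⊑ H × v ∈ V D × suppressCircle S D v ≡ D′)
  restore-circle {D′} circ 0∈
    with t ← circle⇒traversal S↓ circ 0∈ (inj₁ (refl , refl))
    with p , vs , es ← lower (Traversal.path t) (Traversal.fresh t) =
    cycle S f r , cycle-circle S sub r f∈ r⊆ closes f∉r , cycle⊑ S sub r f∈ r⊆ closes f∉r
    , ∈-fromList⁺ {xs = verts S r} (here refl) , part-≡ (V⊆ , E⊆) (V⊇ , E⊇)
    where
    open Traversal t using (∈V⇒; ⇒∈V; ∈E⇒; ⇒∈E)
    f∈ = proj₁ (⇒at-v (here refl))
    at-v-f = proj₂ (⇒at-v (here refl))
    g∈ = proj₁ (⇒at-v (there (here refl)))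
    at-v-g = proj₂ (⇒at-v (there (here refl)))

    v∉ : v ∉ˡ verts S p
    v∉ v∈ = proj₂ (∈-delete⁻ S {H}
      (IsSubgraph.V⊆ (IsCircle.isSubgraph circ) (⇒∈V (subst (_ ∈ˡ_) vs v∈)))) refl

    r : Path S v (otherEnd S f v)
    r = step g (joins-otherEnd at-v-g) p v∉

    closes : Joins S f (otherEnd S f v) v
    closes = joins-sym S (joins-otherEnd at-v-f)

    p⇒D′ : ∀ {k} → k ∈ˡ edges S p → suc k ∈ E D′
    p⇒D′ k∈ = ⇒∈E (there (subst (_ ∈ˡ_) (sym es) (∈-map⁺ suc k∈)))

    D′⇒p : ∀ {k} → suc k ∈ E D′ → k ∈ˡ edges S p
    D′⇒p k∈ with there k∈q ← ∈E⇒ k∈ with _ , k∈p , refl ← ∈-map⁻ suc (subst (_ ∈ˡ_) es k∈q) = k∈p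

    p⊆ : ∀ {k} → k ∈ˡ edges S p → k ∈ E H
    p⊆ k∈ = proj₁ (∈E-delete⁻ S {H} (drop-there (IsSubgraph.E⊆ (IsCircle.isSubgraph circ) (p⇒D′ k∈))))

    r⊆ : ∀ {k} → k ∈ˡ edges S r → k ∈ E H
    r⊆ (here refl) = g∈
    r⊆ (there k∈) = p⊆ k∈

    f∉r : f ∉ˡ edges S r
    f∉r (here f≡g) = f≢g f≡g
    f∉r (there f∈p) = away⇒∉edges S p v∉ at-v-f f∈p

    V⊆ : V (cycle S f r) - v ⊆ V D′
    V⊆ z∈ with z∈C , z≢v ← ∈-delete⁻ S {cycle S f r} z∈ with ∈-fromList⁻ (verts S r) z∈C
    ... | here z≡v = contradiction z≡v z≢v
    ... | there z∈p = ⇒∈V (subst (_ ∈ˡ_) vs z∈p)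

    V⊇ : V D′ ⊆ V (cycle S f r) - v
    V⊇ z∈ with z∈p ← subst (_ ∈ˡ_) (sym vs) (∈V⇒ z∈) =
      x∈p∧x≢y⇒x∈p-y (∈-fromList⁺ {xs = verts S r} (there z∈p)) λ { refl → v∉ z∈p }

    E⊆ : E (suppressCircle S (cycle S f r) v) ⊆ E D′
    E⊆ here = 0∈
    E⊆ (there k∈) with k∈C , away ← ∈E-delete⁻ S {cycle S f r} k∈
      with ∈-fromList⁻ (f ∷ edges S r) k∈C
    ... | here refl = contradiction at-v-f away
    ... | there (here refl) = contradiction at-v-g away
    ... | there (there k∈p) = p⇒D′ k∈p

    E⊇ : E D′ ⊆ E (suppressCircle S (cycle S f r) v)
    E⊇ {zero} _ = here
    E⊇ {suc k} k∈ with k∈p ← D′⇒p k∈ = there (∈E-delete⁺ S {cycle S f r}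
      (∈-fromList⁺ {xs = f ∷ edges S r} (there (there k∈p))) λ inc → away⇒∉edges S p v∉ inc k∈p)

  suppressCircle-injective : ∀ {C D} → IsCircle S C → C ⊑ H → v ∈ V C →
                             IsCircle S D → D ⊑ H → v ∈ V D →
                             suppressCircle S C v ≡ suppressCircle S D v → C ≡ D
  suppressCircle-injective circC C⊑ v∈C circD D⊑ v∈D eq =
    part-≡ (half circD D⊑ v∈C v∈D C⊑ eq) (half circC C⊑ v∈D v∈C D⊑ (sym eq))
    where
    half : ∀ {C D} → IsCircle S D → D ⊑ H → v ∈ V C → v ∈ V D → C ⊑ H →
           suppressCircle S C v ≡ suppressCircle S D v → C ⊑ D
    half {C} {D} circD D⊑ v∈C v∈D C⊑ eq = V⊆ , E⊆
      where
      V⊆ : V C ⊆ V D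
      V⊆ {x} x∈ with x ≟ v
      ... | yes refl = v∈D
      ... | no x≢v = proj₁ (∈-delete⁻ S {D} (subst (λ K → x ∈ V K) eq (x∈p∧x≢y⇒x∈p-y x∈ x≢v)))

      E⊆ : E C ⊆ E D
      E⊆ {e} e∈ with incident? S e v
      ... | no away = proj₁ (∈E-delete⁻ S {D} (drop-there
              (subst (λ K → suc e ∈ E K) eq (there (∈E-delete⁺ S {C} e∈ away)))))
      ... | yes inc with at-v⇒ (proj₂ C⊑ e∈) inc
      ...   | here refl = Suppressed.f∈ (suppress-circle circD D⊑ v∈D)
      ...   | there (here refl) = Suppressed.g∈ (suppress-circle circD D⊑ v∈D)

circle⇒two-edges : ∀ {n m} (S : SignedGraph n m) {C v} → IsCircle S C → v ∈ V C → NoLoopAt S C v →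
  ∃[ e ] ∃[ h ] (e ≢ h × (∀ {k} → (k ∈ E C × Incident S k v) ⇔ k ∈ˡ e ∷ h ∷ []))
circle⇒two-edges S {C} {v} circle v∈ nl
  with e , e∈ , inc ← circle-incident S circle v∈
  with y , j ← incident⇒joins S inc
  with circle⇒traversal S circle e∈ (joins-sym S j)
... | record { path = stop _ } = contradiction j
        λ { (inj₁ ends) → nl e e∈ ends ; (inj₂ ends) → nl e e∈ ends }
... | record { path = step h jh p v∉ ; fresh = fresh ; ∈E⇒ = ∈E⇒ ; ⇒∈E = ⇒∈E } =
  e , h , (λ { refl → fresh (here refl) }) , mk⇔
    (λ (k∈ , inc′) → [ (λ k≡e → here k≡e) , [ (λ k≡h → there (here k≡h))
                     , (λ k∈p → contradiction k∈p (away⇒∉edges S p v∉ inc′)) ]′ ∘ Any.toSum ]′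
                     (Any.toSum (∈E⇒ k∈)))
    λ { (here refl) → e∈ , inc
      ; (there (here refl)) → ⇒∈E (there (here refl)) , joins⇒incidentˡ S jh }

-- The two implications

module _ {n m : ℕ} (S : SignedGraph n m) {v : Fin n} {C : Part n m} (circ : IsCircle S C) (v∈ : v ∈ V C)
         (loopless : ∀ e → e ∈ E C → SignedGraph.end₁ S e ≢ SignedGraph.end₂ S e)
         {B : Part n m} (blk : IsBlock S B) (C⊑B : C ⊑ B) where

  private
    -- The absence of loops yields the second vertex that pins down the block of `C`.
    another-vertex : ∃[ b ] (b ∈ V C × v ≢ b)
    another-vertex
      with e , e∈ , inc ← circle-incident S circ v∈
      with b , j ← incident⇒joins S inc =
      b , proj₂ (joins-closed S (IsCircle.isSubgraph circ) e∈ j) , λ { refl → loopless e e∈ (loop j) }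
      where
      loop : ∀ {e} → Joins S e v v → SignedGraph.end₁ S e ≡ SignedGraph.end₂ S e
      loop (inj₁ (p , q)) = trans p (sym q)
      loop (inj₂ (p , q)) = trans p (sym q)

  block-of-circle : ∀ {A} → IsBlock S A → C ⊑ A → A ≡ B
  block-of-circle blkA C⊑A with b , b∈ , v≢b ← another-vertex =
    blocks-sharing-two-vertices S blkA blk (proj₁ C⊑A v∈ , proj₁ C⊑B v∈)
      (proj₁ C⊑A b∈ , proj₁ C⊑B b∈) v≢b

  module _ (battery : NegativeVertexBattery S v C) where
    open NegativeVertexBattery battery

    battery⇒unbalanced : ∀ {A} → C ⊑ A → Unbalanced S A
    battery⇒unbalanced C⊑A balanced with () ← trans (sym negative) (balanced C circle C⊑A)

    -- An unbalanced block at `v` has a negative circle through `v`, which can only be `C`; and `C`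
    -- lies in just one block. Inclusion of parts is decidable, which removes the double negation.
    battery⇒only-unbalanced-block : ∀ A → IsBlock S A → v ∈ V A → Unbalanced S A → A ≡ B
    battery⇒only-unbalanced-block A blkA v∈A unbalanced =
      block-of-circle blkA $ decidable-stable (_⊑?_ S C A) λ C⋢A →
        unbalanced⇒negative-circle S (IsBlock.inseparable blkA) unbalanced v∈A
          λ (D , circD , D⊑A , negD , v∈D) → C⋢A (subst (_⊑ A) (unique D circD v∈D negD) D⊑A)

    battery⇒edges-in-circle : ∀ {f} → f ∈ E B → Incident S f v → f ∈ E C
    battery⇒edges-in-circle {f} f∈B inc
      with u , j ← incident⇒joins S inc = decidable-stable (f ∈? E C) λ f∉C →
        negative-ear S (IsBlock.inseparable blk) circ C⊑B negative v∈ f∈B f∉C j (v≢u j)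
          λ (D , circD , _ , negD , f∈D) → f∉C
            (subst (λ K → f ∈ E K) (unique D circD
              (incident-closed S (IsCircle.isSubgraph circD) f∈D inc) negD) f∈D)
      where
      -- `negative-ear` asks for an edge with distinct ends. A loop at `v` is impossible because `B`
      -- contains the second vertex of `C`.
      v≢u : ∀ {u} → Joins S f v u → v ≢ u
      v≢u j refl with b , b∈ , v≢b ← another-vertex =
        [ no-loop , no-loop ]′ j
        where
        no-loop = inseparable⇒noLoop S (IsBlock.inseparable blk)
                    (proj₁ C⊑B v∈) (proj₁ C⊑B b∈) v≢b v f f∈B

    battery⇒deg≡2 : deg S B v ≡ 2
    battery⇒deg≡2
      with e , h , e≢h , at-v ← circle⇒two-edges S circ v∈ (λ e e∈ (p , q) → loopless e e∈ (trans p (sym q))) =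
      ≤-antisym
        (unique⇒length≤ (filter⁺ P? (allFin⁺ m)) λ k∈ →
          let _ , k∈B , inc = ∈-filter⁻ P? {xs = allFin m} k∈
          in Equivalence.to at-v (battery⇒edges-in-circle k∈B inc , inc))
        (unique⇒length≤ ((e≢h ∷ []) ∷ [] ∷ []) λ k∈ →
          let k∈C , inc = Equivalence.from at-v k∈
          in ∈-filter⁺ P? (∈-allFin _) (proj₂ C⊑B k∈C , inc))
      where
      P? = λ k → (k ∈? E B) ×-dec incident? S k v

    battery⇒edge-battery : ∀ d → NegativeEdgeBattery (suppressBlock S blk v d) zero (suppressCircle S C v)
    battery⇒edge-battery d = record
      { circle = Suppressed.circle C↓
      ; contains = here
      ; negative = trans (Suppressed.sign C↓) negative
      ; unique = λ D′ circ′ 0∈ neg′ → unique′ (restore-circle circ′ 0∈) neg′ }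
      where
      open Suppression S (IsBlock.isSubgraph blk) v d (block-noLoop S blk v d)
      C↓ = suppress-circle circ C⊑B v∈

      unique′ : ∀ {D′} → ∃[ D ] (IsCircle S D × D ⊑ B × v ∈ V D × suppressCircle S D v ≡ D′) →
                Negative S↓ D′ → D′ ≡ suppressCircle S C v
      unique′ (D , circD , D⊑B , v∈D , refl) neg′ = cong (λ K → suppressCircle S K v) (unique D circD v∈D
        (trans (sym (Suppressed.sign (suppress-circle circD D⊑B v∈D))) neg′))

  -- The point is that a negative circle through `v` cannot lie outside `B`: being inseparable, it
  -- lies in some block, which it makes unbalanced, so that block is `B`. Inside `B`, uniqueness is
  -- carried back along the injective, sign-preserving suppression of circles.
  edge-battery⇒battery : (∀ A → IsBlock S A → v ∈ V A → Unbalanced S A → A ≡ B) →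
    ∀ d → NegativeEdgeBattery (suppressBlock S blk v d) zero (suppressCircle S C v) →
    NegativeVertexBattery S v C
  edge-battery⇒battery only d battery = record
    { circle = circ
    ; contains = v∈
    ; negative = trans (sym (Suppressed.sign (suppress-circle circ C⊑B v∈))) negative
    ; unique = λ D circD v∈D negD →
        let D⊑B = in-B circD v∈D negD
            D↓  = suppress-circle circD D⊑B v∈D
        in suppressCircle-injective circD D⊑B v∈D circ C⊑B v∈
             (unique _ (Suppressed.circle D↓) here (trans (Suppressed.sign D↓) negD)) }
    where
    open Suppression S (IsBlock.isSubgraph blk) v d (block-noLoop S blk v d)
    open NegativeEdgeBattery battery using (negative; unique)

    in-B : ∀ {D} → IsCircle S D → v ∈ V D → Negative S D → D ⊑ B
    in-B {D} circD v∈D negD = decidable-stable (_⊑?_ S D B) λ D⋢B →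
      inseparable⇒in-block S (circle⇒inseparable S circD) λ (A , blkA , D⊑A) →
        D⋢B (subst (D ⊑_) (only A blkA (proj₁ D⊑A v∈D) λ balanced →
          case trans (sym negD) (balanced D circD D⊑A) of λ ()) D⊑A)

mainTheorem10 : ∀ {n m : ℕ} (S : SignedGraph n m) (v : Fin n) →
    v ∈ SignedGraph.V S →
    (∀ A → IsBlock S A → v ∈ V A → ∃[ D ] (IsCircle S D × D ⊑ A)) →
    (C : Part n m) → IsCircle S C → v ∈ V C →
    (∀ e → e ∈ E C → SignedGraph.end₁ S e ≢ SignedGraph.end₂ S e) →
    (B : Part n m) (blk : IsBlock S B) → C ⊑ B →
    NegativeVertexBattery S v C
    ⇔
    ( (Unbalanced S B × (∀ A → IsBlock S A → v ∈ V A → Unbalanced S A → A ≡ B))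
    × (Σ[ d ∈ deg S B v ≡ 2 ]
    NegativeEdgeBattery (suppressBlock S blk v d) zero (suppressCircle S C v)) )
mainTheorem10 S v _ _ C circ v∈ loopless B blk C⊑B = mk⇔
  (λ battery →
      (battery⇒unbalanced S circ v∈ loopless blk C⊑B battery C⊑B
      , battery⇒only-unbalanced-block S circ v∈ loopless blk C⊑B battery)
    , battery⇒deg≡2 S circ v∈ loopless blk C⊑B battery
    , battery⇒edge-battery S circ v∈ loopless blk C⊑B battery _)
  λ ((_ , only) , d , battery) → edge-battery⇒battery S circ v∈ loopless blk C⊑B only d battery
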